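{- For every integer $r\ge 3$ there is a constant $c_r>0$ such that every $K_r$-free graph $G$ with $n$ vertices and average degree $d$ satisfies $\mathrm{sp}(G)\ge c_r\, d^{r-1}/n^{r-3}$.
   Context: All graphs are finite and simple. A graph is $K_r$-free if it has no complete subgraph on $r$ vertices. $\mathrm{mc}(G)$ denotes the maximum number of edges crossing a partition of $V(G)$ into two parts, and $\mathrm{sp}(G)=\mathrm{mc}(G)-e(G)/2$. -}

module Defs where

open import Data.Nat using (ℕ; zero; suc; _⊔_; _<ᵇ_; NonZero) renaming (_+_ to _+ℕ_; _*_ to _*ℕ_)
open import Data.Bool using (Bool; true; false; _∧_; _xor_; if_then_else_; T)
open import Data.Fin using (Fin; toℕ)
open import Data.List using (List; []; _∷_; map; foldr; concatMap; allFin)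
open import Data.Nat.ListAction using (sum)
open import Data.Vec.Functional using (Vector) renaming (_∷_ to _∷ᵥ_)
open import Data.Integer using (+_)
open import Data.Rational using (ℚ; _/_; _*_; _-_; 1ℚ)
open import Relation.Binary.PropositionalEquality using (_≡_; _≢_)

record Graph (n : ℕ) : Set where
  field
    adj    : Fin n → Fin n → Bool
    sym    : ∀ i j → adj i j ≡ adj j i
    irrefl : ∀ i → adj i i ≡ false
open Graph public

countPairs : {n : ℕ} → (Fin n → Fin n → Bool) → ℕ
countPairs {n} p =
  sum (map (λ i → sum (map (λ j → if (toℕ i <ᵇ toℕ j) ∧ p i j then 1 else 0) (allFin n))) (allFin n))

e : {n : ℕ} → Graph n → ℕ
e G = countPairs (adj G)

cut : {n : ℕ} → Graph n → (Fin n → Bool) → ℕ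
cut G S = countPairs (λ i j → adj G i j ∧ (S i xor S j))

subsets : (n : ℕ) → List (Fin n → Bool)
subsets zero = (λ ()) ∷ []
subsets (suc n) = concatMap (λ S → (true ∷ᵥ S) ∷ (false ∷ᵥ S) ∷ []) (subsets n)

mc : {n : ℕ} → Graph n → ℕ
mc {n} G = foldr _⊔_ 0 (map (cut G) (subsets n))

sp : {n : ℕ} → Graph n → ℚ
sp G = ((+ mc G) / 1) - ((+ e G) / 2)

KrFree : (r : ℕ) → {n : ℕ} → Graph n → Set
KrFree r {n} G = (f : Fin r → Fin n) → ¬K f
  where
    ¬K : (Fin r → Fin n) → Set
    ¬K f = ((i j : Fin r) → i ≢ j → T (adj G (f i) (f j))) → Data.Empty.⊥
      where import Data.Empty

avgDeg : {n : ℕ} → .{{_ : NonZero n}} → Graph n → ℚ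
avgDeg {n} G = (+ (2 *ℕ e G)) / n

_^ℚ_ : ℚ → ℕ → ℚ
q ^ℚ zero = 1ℚ
q ^ℚ suc k = q * (q ^ℚ k)

{-# OPTIONS --safe #-}
-- For x ∈ [-1,1]^V let Q(x) = Σ a_ij x_i x_j; minus Q of a sign vector is four times its surplus, and rounding the
-- coordinates one at a time turns any x into signs without increasing Q. Write m = Σ d_i = 2e(G) and replace Q by
-- m Q(x) - (Σ d_i x_i)² = m Q(x - t), t being the degree-weighted mean of x. By the parallelogram law, the values
-- of this form at vectors with disjoint supports can be combined subadditively, by choosing signs greedily.
-- As long as the vertices of degree at least d/2 not yet used have volume at least m/4, some neighbourhood meets them
-- in a set W of volume z ≥ m²/8N². If W spans few edges, the indicator of W gains z²/2; otherwise W spans a dense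
-- K_{r-1}-free graph and induction on r gives signs on W with a large gain.

module Submission where

open import Defs
open import Data.Nat using (ℕ; _≤_; _∸_; NonZero; zero; suc)
open import Data.Integer using (+_; -[1+_]; ∣_∣; ℤ; 0ℤ; 1ℤ; -1ℤ)
open import Data.Rational using (ℚ; Positive; _/_; _*_; toℚᵘ) renaming (_≤_ to _≤ℚ_)
open import Data.Product using (Σ; _×_; _,_; ∃-syntax; proj₁; proj₂)
open import Data.Sum using (_⊎_; inj₁; inj₂)
open import Data.Bool using (Bool; true; false; _∧_; _xor_; not; if_then_else_; T)
open import Data.Bool.Properties using (∧-comm; T-∧; xor-comm)
open import Data.Empty using (⊥-elim)
open import Data.Unit using (tt)
open import Data.Fin using (Fin; zero; suc; toℕ)
import Data.Fin.Properties as Fin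
import Data.Nat as ℕ
import Data.Nat.Properties as ℕ
import Data.Nat.Tactic.RingSolver as ℕ-Ring
import Data.Nat.ListAction as ListAction
import Data.Integer as ℤ
import Data.Integer.Properties as ℤ
import Data.Integer.Tactic.RingSolver as ℤ-Ring
import Data.Rational.Properties as ℚ
open import Data.Rational.Unnormalised using (mkℚᵘ; _≃_; *≤*)
import Data.Rational.Unnormalised as ℚᵘ
import Data.Rational.Unnormalised.Properties as ℚᵘ
open import Data.List using ([]; _∷_; foldr; map; allFin; tabulate)
import Data.List.Properties as List
open import Data.List.Relation.Unary.Any using (Any; here; there)
import Data.List.Relation.Unary.Any as Any
open import Data.List.Relation.Unary.Any.Properties using (concatMap⁺)
open import Data.Vec.Functional using () renaming (_∷_ to _∷ᵥ_)
import Algebra.Properties.Semiring.Sum ℕ.+-*-semiring as ℕ-Sum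
import Algebra.Properties.Semiring.Sum ℤ.+-*-semiring as ℤ-Sum
open import Function using (_∘_; Equivalence)
open import Relation.Binary using (tri<; tri≈; tri>)
open import Relation.Nullary using (Dec; ¬_; yes; no)
open import Relation.Binary.PropositionalEquality using (_≡_; _≢_; refl; trans; cong; cong₂; subst; subst₂; module ≡-Reasoning) renaming (sym to ≡-sym)

-- The indicator of a vertex set never has negative energy, so `Q` alone sees no gain in a sparse
-- neighbourhood. Shifting `x` by a constant t gives Q(x) - 2t Σ d_i x_i + m t², which is least at
-- the degree-weighted mean. The amount saved, (Σ d_i x_i)²/m, is itself quadratic in `x`, so the
-- centred expression is again a quadratic form. Pieces can therefore be added before any mean is
-- subtracted: a combination over disjoint supports still has entries in [-1,1], and the single
-- shift at the end costs a factor that does not grow with the number of pieces. The lower bound on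
-- z is there because a piece gains about z², while gains add up to a usable total only if each is
-- proportional to the volume it consumes. The degree condition serves twice: it forces a large
-- neighbourhood, and it gives |W| ≤ 2Nz/m, so that the induction is applied to a graph on few
-- vertices.

-- Finite sums of naturals and integers.

-- Opaque, so that unification can read the summand off a sum.
opaque
  ∑ℕ : ∀ {n} → (Fin n → ℕ) → ℕ
  ∑ℕ = ℕ-Sum.sum

  ∑ℤ : ∀ {n} → (Fin n → ℤ) → ℤ
  ∑ℤ = ℤ-Sum.sum

opaque
  unfolding ∑ℕ ∑ℤ

  ∑ℕ-suc : ∀ {n} (f : Fin (suc n) → ℕ) → ∑ℕ f ≡ f zero ℕ.+ ∑ℕ (f ∘ suc)
  ∑ℕ-suc f = refl

  ∑ℕ-cong : ∀ {n} {f g : Fin n → ℕ} → (∀ i → f i ≡ g i) → ∑ℕ f ≡ ∑ℕ g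
  ∑ℕ-cong = ℕ-Sum.sum-cong-≗

  ∑ℕ-distrib-+ : ∀ {n} (f g : Fin n → ℕ) → ∑ℕ (λ i → f i ℕ.+ g i) ≡ ∑ℕ f ℕ.+ ∑ℕ g
  ∑ℕ-distrib-+ = ℕ-Sum.∑-distrib-+

  ∑ℕ-comm : ∀ {m n} (f : Fin m → Fin n → ℕ) → ∑ℕ (λ i → ∑ℕ (f i)) ≡ ∑ℕ (λ j → ∑ℕ (λ i → f i j))
  ∑ℕ-comm = ℕ-Sum.∑-comm

  *-distribˡ-∑ℕ : ∀ {n} a (f : Fin n → ℕ) → a ℕ.* ∑ℕ f ≡ ∑ℕ (λ i → a ℕ.* f i)
  *-distribˡ-∑ℕ = ℕ-Sum.*-distribˡ-sum

  ∑ℕ-mono : ∀ {n} {f g : Fin n → ℕ} → (∀ i → f i ≤ g i) → ∑ℕ f ≤ ∑ℕ g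
  ∑ℕ-mono {zero}  f≤g = ℕ.z≤n
  ∑ℕ-mono {suc n} f≤g = ℕ.+-mono-≤ (f≤g zero) (∑ℕ-mono (f≤g ∘ suc))

  ∑ℕ-zero : ∀ {n} (f : Fin n → ℕ) → (∀ i → f i ≡ 0) → ∑ℕ f ≡ 0
  ∑ℕ-zero {n} f f≡0 = trans (∑ℕ-cong f≡0) (ℕ-Sum.sum-replicate-zero n)

  ∑ℤ-suc : ∀ {n} (f : Fin (suc n) → ℤ) → ∑ℤ f ≡ f zero ℤ.+ ∑ℤ (f ∘ suc)
  ∑ℤ-suc f = refl

  ∑ℤ-cong : ∀ {n} {f g : Fin n → ℤ} → (∀ i → f i ≡ g i) → ∑ℤ f ≡ ∑ℤ g
  ∑ℤ-cong = ℤ-Sum.sum-cong-≗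

  ∑ℤ-distrib-+ : ∀ {n} (f g : Fin n → ℤ) → ∑ℤ (λ i → f i ℤ.+ g i) ≡ ∑ℤ f ℤ.+ ∑ℤ g
  ∑ℤ-distrib-+ = ℤ-Sum.∑-distrib-+

  ∑ℤ-comm : ∀ {m n} (f : Fin m → Fin n → ℤ) → ∑ℤ (λ i → ∑ℤ (f i)) ≡ ∑ℤ (λ j → ∑ℤ (λ i → f i j))
  ∑ℤ-comm = ℤ-Sum.∑-comm

  *-distribˡ-∑ℤ : ∀ {n} a (f : Fin n → ℤ) → a ℤ.* ∑ℤ f ≡ ∑ℤ (λ i → a ℤ.* f i)
  *-distribˡ-∑ℤ = ℤ-Sum.*-distribˡ-sum

  +-∑ : ∀ {n} (f : Fin n → ℕ) → + ∑ℕ f ≡ ∑ℤ (λ i → + f i)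
  +-∑ {zero}  f = refl
  +-∑ {suc n} f = cong (λ z → + f zero ℤ.+ z) (+-∑ (f ∘ suc))

  ∣∑∣≤∑∣∣ : ∀ {n} (f : Fin n → ℤ) → ∣ ∑ℤ f ∣ ≤ ∑ℕ (λ i → ∣ f i ∣)
  ∣∑∣≤∑∣∣ {zero}  f = ℕ.z≤n
  ∣∑∣≤∑∣∣ {suc n} f = ℕ.≤-trans (ℤ.∣i+j∣≤∣i∣+∣j∣ (f zero) _) (ℕ.+-monoʳ-≤ ∣ f zero ∣ (∣∑∣≤∑∣∣ (f ∘ suc)))

∑ℤ-lin : ∀ {n} a b (f g : Fin n → ℤ) →
         ∑ℤ (λ i → a ℤ.* f i ℤ.+ b ℤ.* g i) ≡ a ℤ.* ∑ℤ f ℤ.+ b ℤ.* ∑ℤ g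
∑ℤ-lin a b f g = trans (∑ℤ-distrib-+ (λ i → a ℤ.* f i) (λ i → b ℤ.* g i))
  (≡-sym (cong₂ ℤ._+_ (*-distribˡ-∑ℤ a f) (*-distribˡ-∑ℤ b g)))

-- Quadratic forms and rounding to signs.

Matrix : ℕ → Set
Matrix n = Fin n → Fin n → ℤ

form : ∀ {n} → Matrix n → (Fin n → ℤ) → ℤ
form M x = ∑ℤ (λ i → ∑ℤ (λ j → x i ℤ.* (M i j ℤ.* x j)))

form-cong : ∀ {n} (M : Matrix n) {x y} → (∀ i → x i ≡ y i) → form M x ≡ form M y
form-cong M x≗y = ∑ℤ-cong (λ i → ∑ℤ-cong (λ j → cong₂ (λ a b → a ℤ.* (M i j ℤ.* b)) (x≗y i) (x≗y j)))

form-scale : ∀ {n} (M : Matrix n) c x → form M (λ i → c ℤ.* x i) ≡ c ℤ.* c ℤ.* form M x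
form-scale M c x = ≡-sym (trans (*-distribˡ-∑ℤ (c ℤ.* c) _) (∑ℤ-cong (λ i →
  trans (*-distribˡ-∑ℤ (c ℤ.* c) _) (∑ℤ-cong (λ j → ring c (x i) (M i j) (x j))))))
  where
  ring : ∀ c a m b → c ℤ.* c ℤ.* (a ℤ.* (m ℤ.* b)) ≡ c ℤ.* a ℤ.* (m ℤ.* (c ℤ.* b))
  ring = ℤ-Ring.solve-∀

form-parallelogram : ∀ {n} (M : Matrix n) (x y : Fin n → ℤ) →
  form M (λ i → x i ℤ.+ y i) ℤ.+ form M (λ i → x i ℤ.- y i) ≡ (form M x ℤ.+ form M y) ℤ.+ (form M x ℤ.+ form M y)
form-parallelogram M x y =
  trans (≡-sym (∑ℤ-distrib-+ _ _)) (trans (∑ℤ-cong inner)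
    (trans (∑ℤ-distrib-+ _ _) (cong₂ ℤ._+_ (∑ℤ-distrib-+ _ _) (∑ℤ-distrib-+ _ _))))
  where
  ring : ∀ a b m c d → (a ℤ.+ b) ℤ.* (m ℤ.* (c ℤ.+ d)) ℤ.+ (a ℤ.- b) ℤ.* (m ℤ.* (c ℤ.- d))
       ≡ (a ℤ.* (m ℤ.* c) ℤ.+ b ℤ.* (m ℤ.* d)) ℤ.+ (a ℤ.* (m ℤ.* c) ℤ.+ b ℤ.* (m ℤ.* d))
  ring = ℤ-Ring.solve-∀
  row : (Fin _ → ℤ) → Fin _ → ℤ
  row z i = ∑ℤ (λ j → z i ℤ.* (M i j ℤ.* z j))
  inner : ∀ i → row (λ i → x i ℤ.+ y i) i ℤ.+ row (λ i → x i ℤ.- y i) i ≡ (row x i ℤ.+ row y i) ℤ.+ (row x i ℤ.+ row y i)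
  inner i = trans (≡-sym (∑ℤ-distrib-+ _ _)) (trans (∑ℤ-cong (λ j → ring (x i) (y i) (M i j) (x j) (y j)))
    (trans (∑ℤ-distrib-+ _ _) (cong₂ ℤ._+_ (∑ℤ-distrib-+ _ _) (∑ℤ-distrib-+ _ _))))

σ : Bool → ℤ
σ true  = 1ℤ
σ false = -1ℤ

-- A linear function on an interval is least at an end: the sign to take is opposite to that of `c`.
endpoint : ∀ B x c → ∣ x ∣ ≤ B → ∃[ s ] (+ B ℤ.* σ s) ℤ.* c ℤ.≤ x ℤ.* c
endpoint B x (+ k) x≤B = false , ℤ.*-monoʳ-≤-nonNeg (+ k) (subst (ℤ._≤ x) eq lower)
  where
  lower : ℤ.- + B ℤ.≤ x
  lower = ℤ.≤-trans (ℤ.neg-mono-≤ (ℤ.+≤+ x≤B)) (-∣∣≤ x)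
    where
    -∣∣≤ : ∀ x → ℤ.- + ∣ x ∣ ℤ.≤ x
    -∣∣≤ (+ zero) = ℤ.≤-refl
    -∣∣≤ (+ suc n) = ℤ.-≤+
    -∣∣≤ -[1+ n ] = ℤ.≤-refl
  ring : ∀ b → ℤ.- b ≡ b ℤ.* (ℤ.- 1ℤ)
  ring = ℤ-Ring.solve-∀
  eq : ℤ.- + B ≡ + B ℤ.* -1ℤ
  eq = ring (+ B)
endpoint B x -[1+ k ] x≤B = true , ℤ.*-monoʳ-≤-nonPos -[1+ k ] (subst (x ℤ.≤_) (≡-sym (ℤ.*-identityʳ (+ B))) upper)
  where
  ≤∣∣ : ∀ x → x ℤ.≤ + ∣ x ∣
  ≤∣∣ (+ n) = ℤ.≤-refl
  ≤∣∣ -[1+ n ] = ℤ.-≤+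
  upper : x ℤ.≤ + B
  upper = ℤ.≤-trans (≤∣∣ x) (ℤ.+≤+ x≤B)

-- The linear term makes the class closed under fixing a coordinate, as the induction on the
-- dimension requires.
affine : ∀ {n} → Matrix n → (Fin n → ℤ) → (Fin n → ℤ) → ℤ
affine M b x = form M x ℤ.+ ∑ℤ (λ i → b i ℤ.* x i)

minor : ∀ {n} → Matrix (suc n) → Matrix n
minor M i j = M (suc i) (suc j)

-- The linear term left on the other coordinates once coordinate `zero` has the value `a`. Row and
-- column `zero` contribute equally by symmetry, hence the doubling.
absorb : ∀ {n} → Matrix (suc n) → (Fin (suc n) → ℤ) → ℤ → Fin n → ℤ
absorb M b a i = b (suc i) ℤ.+ (a ℤ.* M zero (suc i) ℤ.+ a ℤ.* M zero (suc i))

affine-absorb : ∀ {n} (M : Matrix (suc n)) b a x → let r = ∑ℤ (λ i → M zero (suc i) ℤ.* x i) in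
  affine (minor M) (absorb M b a) x ≡ a ℤ.* (r ℤ.+ r) ℤ.+ affine (minor M) (b ∘ suc) x
affine-absorb M b a x = trans (cong (λ z → form (minor M) x ℤ.+ z) lin) (ring₂ (form (minor M) x) _ a r)
  where
  r = ∑ℤ (λ i → M zero (suc i) ℤ.* x i)
  ring₁ : ∀ b a m x → (b ℤ.+ (a ℤ.* m ℤ.+ a ℤ.* m)) ℤ.* x ≡ 1ℤ ℤ.* (b ℤ.* x) ℤ.+ (a ℤ.+ a) ℤ.* (m ℤ.* x)
  ring₁ = ℤ-Ring.solve-∀
  lin : ∑ℤ (λ i → absorb M b a i ℤ.* x i) ≡ 1ℤ ℤ.* ∑ℤ (λ i → b (suc i) ℤ.* x i) ℤ.+ (a ℤ.+ a) ℤ.* r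
  lin = trans (∑ℤ-cong (λ i → ring₁ (b (suc i)) a (M zero (suc i)) (x i))) (∑ℤ-lin 1ℤ (a ℤ.+ a) _ _)
  ring₂ : ∀ q l a r → q ℤ.+ (1ℤ ℤ.* l ℤ.+ (a ℤ.+ a) ℤ.* r) ≡ a ℤ.* (r ℤ.+ r) ℤ.+ (q ℤ.+ l)
  ring₂ = ℤ-Ring.solve-∀

record Adjacency {n} (M : Matrix n) : Set where
  field
    symmetric : ∀ i j → M i j ≡ M j i
    hollow    : ∀ i → M i i ≡ 0ℤ
open Adjacency

minor-adjacency : ∀ {n} {M : Matrix (suc n)} → Adjacency M → Adjacency (minor M)
minor-adjacency adj .symmetric i j = adj .symmetric (suc i) (suc j)
minor-adjacency adj .hollow i      = adj .hollow (suc i)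

affine-split : ∀ {n} {M : Matrix (suc n)} → Adjacency M → ∀ b x →
  affine M b x ≡ x zero ℤ.* b zero ℤ.+ affine (minor M) (absorb M b (x zero)) (x ∘ suc)
affine-split {n} {M} adj b x = begin
  affine M b x
    ≡⟨ cong₂ ℤ._+_ (trans (∑ℤ-suc _) (cong₂ ℤ._+_ (∑ℤ-suc _) (∑ℤ-cong (λ i → ∑ℤ-suc _)))) (∑ℤ-suc _) ⟩
  (x₀ ℤ.* (M zero zero ℤ.* x₀) ℤ.+ top) ℤ.+ ∑ℤ (λ i → x (suc i) ℤ.* (M (suc i) zero ℤ.* x₀) ℤ.+ rest i) ℤ.+ (b zero ℤ.* x₀ ℤ.+ l)
    ≡⟨ cong (λ z → (x₀ ℤ.* (z ℤ.* x₀) ℤ.+ top) ℤ.+ ∑ℤ (λ i → x (suc i) ℤ.* (M (suc i) zero ℤ.* x₀) ℤ.+ rest i) ℤ.+ (b zero ℤ.* x₀ ℤ.+ l)) (adj .hollow zero) ⟩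
  (x₀ ℤ.* (0ℤ ℤ.* x₀) ℤ.+ top) ℤ.+ ∑ℤ (λ i → x (suc i) ℤ.* (M (suc i) zero ℤ.* x₀) ℤ.+ rest i) ℤ.+ (b zero ℤ.* x₀ ℤ.+ l)
    ≡⟨ cong₂ (λ t s → (x₀ ℤ.* (0ℤ ℤ.* x₀) ℤ.+ t) ℤ.+ s ℤ.+ (b zero ℤ.* x₀ ℤ.+ l)) (≡-sym (*-distribˡ-∑ℤ x₀ _)) left ⟩
  (x₀ ℤ.* (0ℤ ℤ.* x₀) ℤ.+ x₀ ℤ.* r) ℤ.+ (x₀ ℤ.* r ℤ.+ q) ℤ.+ (b zero ℤ.* x₀ ℤ.+ l)
    ≡⟨ ring x₀ r q (b zero) l ⟩
  x₀ ℤ.* b zero ℤ.+ (x₀ ℤ.* (r ℤ.+ r) ℤ.+ (q ℤ.+ l))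
    ≡⟨ cong (λ z → x₀ ℤ.* b zero ℤ.+ z) (≡-sym (affine-absorb M b x₀ (x ∘ suc))) ⟩
  x₀ ℤ.* b zero ℤ.+ affine (minor M) (absorb M b x₀) (x ∘ suc) ∎
  where
  open ≡-Reasoning
  x₀ = x zero
  r = ∑ℤ (λ i → M zero (suc i) ℤ.* x (suc i))
  top = ∑ℤ (λ j → x₀ ℤ.* (M zero (suc j) ℤ.* x (suc j)))
  rest : Fin n → ℤ
  rest i = ∑ℤ (λ j → x (suc i) ℤ.* (M (suc i) (suc j) ℤ.* x (suc j)))
  q = form (minor M) (x ∘ suc)
  l = ∑ℤ (λ i → b (suc i) ℤ.* x (suc i))
  swap : ∀ x m y → x ℤ.* (m ℤ.* y) ≡ y ℤ.* (m ℤ.* x)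
  swap = ℤ-Ring.solve-∀
  left : ∑ℤ (λ i → x (suc i) ℤ.* (M (suc i) zero ℤ.* x₀) ℤ.+ rest i) ≡ x₀ ℤ.* r ℤ.+ q
  left = trans (∑ℤ-distrib-+ (λ i → x (suc i) ℤ.* (M (suc i) zero ℤ.* x₀)) rest) (cong (ℤ._+ q) (trans
    (∑ℤ-cong (λ i → trans (swap (x (suc i)) (M (suc i) zero) x₀) (cong (λ z → x₀ ℤ.* (z ℤ.* x (suc i))) (adj .symmetric (suc i) zero))))
    (≡-sym (*-distribˡ-∑ℤ x₀ _))))
  ring : ∀ x r q b l → (x ℤ.* (0ℤ ℤ.* x) ℤ.+ x ℤ.* r) ℤ.+ (x ℤ.* r ℤ.+ q) ℤ.+ (b ℤ.* x ℤ.+ l) ≡ x ℤ.* b ℤ.+ (x ℤ.* (r ℤ.+ r) ℤ.+ (q ℤ.+ l))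
  ring = ℤ-Ring.solve-∀

-- A zero diagonal leaves no square of a coordinate, so the expression is affine in each coordinate
-- separately and `endpoint` applies. The first sign is chosen against the original values of the
-- later coordinates, which are then rounded with that sign fixed.
affine-rounding : ∀ {n} {M : Matrix n} → Adjacency M → ∀ b x B → (∀ i → ∣ x i ∣ ≤ B) →
  Σ (Fin n → Bool) λ s → affine M b (λ i → + B ℤ.* σ (s i)) ℤ.≤ affine M b x
affine-rounding {zero} {M} adj b x B x≤B = (λ ()) , ℤ.≤-reflexive (cong₂ ℤ._+_ (∑ℤ-cong λ ()) (∑ℤ-cong λ ()))
affine-rounding {suc n} {M} adj b x B x≤B = s , (begin
  affine M b y                                                   ≡⟨ affine-split adj b y ⟩
  y₀ ℤ.* b zero ℤ.+ affine (minor M) (absorb M b y₀) (y ∘ suc)   ≤⟨ ℤ.+-monoʳ-≤ (y₀ ℤ.* b zero) (proj₂ tail) ⟩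
  y₀ ℤ.* b zero ℤ.+ affine (minor M) (absorb M b y₀) (x ∘ suc)   ≡⟨ collect y₀ ⟩
  y₀ ℤ.* c ℤ.+ affine (minor M) (b ∘ suc) (x ∘ suc)              ≤⟨ ℤ.+-monoˡ-≤ _ (proj₂ head) ⟩
  x zero ℤ.* c ℤ.+ affine (minor M) (b ∘ suc) (x ∘ suc)          ≡⟨ collect (x zero) ⟨
  x zero ℤ.* b zero ℤ.+ affine (minor M) (absorb M b (x zero)) (x ∘ suc) ≡⟨ affine-split adj b x ⟨
  affine M b x ∎)
  where
  open ℤ.≤-Reasoning
  r = ∑ℤ (λ i → M zero (suc i) ℤ.* x (suc i))
  c = b zero ℤ.+ (r ℤ.+ r)
  head = endpoint B (x zero) c (x≤B zero)
  y₀ = + B ℤ.* σ (proj₁ head)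
  tail = affine-rounding (minor-adjacency adj) (absorb M b y₀) (x ∘ suc) B (x≤B ∘ suc)
  s : Fin (suc n) → Bool
  s zero    = proj₁ head
  s (suc i) = proj₁ tail i
  y : Fin (suc n) → ℤ
  y i = + B ℤ.* σ (s i)
  ring : ∀ a b r q → a ℤ.* b ℤ.+ (a ℤ.* (r ℤ.+ r) ℤ.+ q) ≡ a ℤ.* (b ℤ.+ (r ℤ.+ r)) ℤ.+ q
  ring = ℤ-Ring.solve-∀
  collect : ∀ a → a ℤ.* b zero ℤ.+ affine (minor M) (absorb M b a) (x ∘ suc) ≡ a ℤ.* c ℤ.+ affine (minor M) (b ∘ suc) (x ∘ suc)
  collect a = trans (cong (λ z → a ℤ.* b zero ℤ.+ z) (affine-absorb M b a (x ∘ suc))) (ring a (b zero) r _)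

rounding : ∀ {n} {M : Matrix n} → Adjacency M → ∀ x B → (∀ i → ∣ x i ∣ ≤ B) →
  Σ (Fin n → Bool) λ s → + B ℤ.* + B ℤ.* form M (σ ∘ s) ℤ.≤ form M x
rounding {n} {M} adj x B x≤B with affine-rounding adj (λ _ → 0ℤ) x B x≤B
... | s , le = s , subst₂ ℤ._≤_ (trans (homogeneous (λ i → + B ℤ.* σ (s i))) (form-scale M (+ B) (σ ∘ s))) (homogeneous x) le
  where
  ring : ∀ q z → q ℤ.+ 0ℤ ℤ.* z ≡ q
  ring = ℤ-Ring.solve-∀
  homogeneous : ∀ y → affine M (λ _ → 0ℤ) y ≡ form M y
  homogeneous y = trans (cong (λ z → form M y ℤ.+ z) (≡-sym (*-distribˡ-∑ℤ 0ℤ y))) (ring (form M y) (∑ℤ y))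

-- The energy of a graph and its centred form.

⟦_⟧ : Bool → ℕ
⟦ true ⟧  = 1
⟦ false ⟧ = 0

⟦∧⟧ : ∀ a b → ⟦ a ∧ b ⟧ ≡ ⟦ a ⟧ ℕ.* ⟦ b ⟧
⟦∧⟧ true  b = ≡-sym (ℕ.+-identityʳ ⟦ b ⟧)
⟦∧⟧ false b = refl

⟦⟧-mono : ∀ {a b} → (T a → T b) → ⟦ a ⟧ ≤ ⟦ b ⟧
⟦⟧-mono {false}         _   = ℕ.z≤n
⟦⟧-mono {true}  {true}  _   = ℕ.≤-refl
⟦⟧-mono {true}  {false} a⇒b = ⊥-elim (a⇒b _)

size : ∀ {n} → (Fin n → Bool) → ℕ
size U = ∑ℕ (λ i → ⟦ U i ⟧)

deg : ∀ {n} → Graph n → Fin n → ℕ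
deg G i = ∑ℕ (λ j → ⟦ adj G i j ⟧)

total : ∀ {n} → Graph n → ℕ
total G = ∑ℕ (deg G)

vol : ∀ {n} → Graph n → (Fin n → Bool) → ℕ
vol G R = ∑ℕ (λ i → ⟦ R i ⟧ ℕ.* deg G i)

adjacency : ∀ {n} → Graph n → Matrix n
adjacency G i j = + ⟦ adj G i j ⟧

isAdjacency : ∀ {n} (G : Graph n) → Adjacency (adjacency G)
isAdjacency G .Adjacency.symmetric i j = cong (λ b → + ⟦ b ⟧) (sym G i j)
isAdjacency G .Adjacency.hollow i      = cong (λ b → + ⟦ b ⟧) (irrefl G i)

energy : ∀ {n} → Graph n → (Fin n → ℤ) → ℤ
energy G = form (adjacency G)

moment : ∀ {n} → Graph n → (Fin n → ℤ) → ℤ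
moment G x = ∑ℤ (λ i → + deg G i ℤ.* x i)

-- total G times the energy of x minus its degree-weighted mean, moment G x / total G; see energy-shift.
centred : ∀ {n} → Graph n → (Fin n → ℤ) → ℤ
centred G x = + total G ℤ.* energy G x ℤ.- moment G x ℤ.* moment G x

-- The adjacency matrix sends the constant vector 1 to the degrees, so each cross term is minus
-- `total G` times the squared moment, and the constant part restores one of the two. Scaling `x` by
-- `total G` keeps the mean an integer.
energy-shift : ∀ {n} (G : Graph n) (x : Fin n → ℤ) →
  energy G (λ i → + total G ℤ.* x i ℤ.- moment G x) ≡ + total G ℤ.* centred G x
energy-shift {n} G x = begin
  energy G (λ i → m ℤ.* x i ℤ.- z)
    ≡⟨ ∑ℤ-cong row ⟩
  ∑ℤ (λ i → (m ℤ.* m ℤ.* (x i ℤ.* Ax i) ℤ.+ k ℤ.* Ax i) ℤ.+ (k ℤ.* (d i ℤ.* x i) ℤ.+ z ℤ.* z ℤ.* d i))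
    ≡⟨ trans (∑ℤ-distrib-+ _ _) (cong₂ ℤ._+_ (∑ℤ-lin (m ℤ.* m) k _ _) (∑ℤ-lin k (z ℤ.* z) _ _)) ⟩
  (m ℤ.* m ℤ.* ∑ℤ (λ i → x i ℤ.* Ax i) ℤ.+ k ℤ.* ∑ℤ Ax) ℤ.+ (k ℤ.* z ℤ.+ z ℤ.* z ℤ.* ∑ℤ d)
    ≡⟨ cong₂ ℤ._+_ (cong₂ (λ p q → m ℤ.* m ℤ.* p ℤ.+ k ℤ.* q) (∑ℤ-cong (λ i → *-distribˡ-∑ℤ (x i) _)) columns)
         (cong (λ t → k ℤ.* z ℤ.+ z ℤ.* z ℤ.* t) (≡-sym (+-∑ (deg G)))) ⟩
  (m ℤ.* m ℤ.* energy G x ℤ.+ k ℤ.* z) ℤ.+ (k ℤ.* z ℤ.+ z ℤ.* z ℤ.* m)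
    ≡⟨ ring m z (energy G x) ⟩
  m ℤ.* centred G x ∎
  where
  open ≡-Reasoning
  m = + total G
  z = moment G x
  k = ℤ.- (m ℤ.* z)
  A = adjacency G
  d : Fin n → ℤ
  d i = + deg G i
  Ax : Fin n → ℤ
  Ax i = ∑ℤ (λ j → A i j ℤ.* x j)
  ring₀ : ∀ m a x z → a ℤ.* (m ℤ.* x ℤ.- z) ≡ m ℤ.* (a ℤ.* x) ℤ.+ (ℤ.- z) ℤ.* a
  ring₀ = ℤ-Ring.solve-∀
  ring₁ : ∀ m z x a d → (m ℤ.* x ℤ.- z) ℤ.* (m ℤ.* a ℤ.+ (ℤ.- z) ℤ.* d)
        ≡ (m ℤ.* m ℤ.* (x ℤ.* a) ℤ.+ (ℤ.- (m ℤ.* z)) ℤ.* a) ℤ.+ ((ℤ.- (m ℤ.* z)) ℤ.* (d ℤ.* x) ℤ.+ z ℤ.* z ℤ.* d)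
  ring₁ = ℤ-Ring.solve-∀
  ring : ∀ m z q → (m ℤ.* m ℤ.* q ℤ.+ (ℤ.- (m ℤ.* z)) ℤ.* z) ℤ.+ ((ℤ.- (m ℤ.* z)) ℤ.* z ℤ.+ z ℤ.* z ℤ.* m) ≡ m ℤ.* (m ℤ.* q ℤ.- z ℤ.* z)
  ring = ℤ-Ring.solve-∀
  inner : ∀ i → ∑ℤ (λ j → A i j ℤ.* (m ℤ.* x j ℤ.- z)) ≡ m ℤ.* Ax i ℤ.+ (ℤ.- z) ℤ.* d i
  inner i = trans (∑ℤ-cong (λ j → ring₀ m (A i j) (x j) z))
    (trans (∑ℤ-lin m (ℤ.- z) _ _) (cong (λ t → m ℤ.* Ax i ℤ.+ (ℤ.- z) ℤ.* t) (≡-sym (+-∑ _))))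
  row : ∀ i → ∑ℤ (λ j → (m ℤ.* x i ℤ.- z) ℤ.* (A i j ℤ.* (m ℤ.* x j ℤ.- z)))
      ≡ (m ℤ.* m ℤ.* (x i ℤ.* Ax i) ℤ.+ k ℤ.* Ax i) ℤ.+ (k ℤ.* (d i ℤ.* x i) ℤ.+ z ℤ.* z ℤ.* d i)
  row i = trans (≡-sym (*-distribˡ-∑ℤ (m ℤ.* x i ℤ.- z) _))
    (trans (cong (λ t → (m ℤ.* x i ℤ.- z) ℤ.* t) (inner i)) (ring₁ m z (x i) (Ax i) (d i)))
  columns : ∑ℤ Ax ≡ z
  columns = trans (∑ℤ-comm _) (∑ℤ-cong (λ j → begin
    ∑ℤ (λ i → A i j ℤ.* x j)  ≡⟨ ∑ℤ-cong (λ i → trans (ℤ.*-comm (A i j) (x j)) (cong (λ b → x j ℤ.* + ⟦ b ⟧) (sym G i j))) ⟩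
    ∑ℤ (λ i → x j ℤ.* A j i)  ≡⟨ ≡-sym (*-distribˡ-∑ℤ (x j) _) ⟩
    x j ℤ.* ∑ℤ (λ i → A j i)  ≡⟨ cong (λ t → x j ℤ.* t) (≡-sym (+-∑ _)) ⟩
    x j ℤ.* d j               ≡⟨ ℤ.*-comm (x j) (d j) ⟩
    d j ℤ.* x j ∎))

-- The moment is linear, so its square obeys the parallelogram law just as the energy does.
centred-parallelogram : ∀ {n} (G : Graph n) (x y : Fin n → ℤ) →
  centred G (λ i → x i ℤ.+ y i) ℤ.+ centred G (λ i → x i ℤ.- y i)
    ≡ (centred G x ℤ.+ centred G y) ℤ.+ (centred G x ℤ.+ centred G y)
centred-parallelogram {n} G x y = begin
  (m ℤ.* E₊ ℤ.- moment G (λ i → x i ℤ.+ y i) ℤ.* moment G (λ i → x i ℤ.+ y i)) ℤ.+ (m ℤ.* E₋ ℤ.- moment G (λ i → x i ℤ.- y i) ℤ.* moment G (λ i → x i ℤ.- y i))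
    ≡⟨ cong₂ (λ s t → (m ℤ.* E₊ ℤ.- s ℤ.* s) ℤ.+ (m ℤ.* E₋ ℤ.- t ℤ.* t)) plus minus ⟩
  (m ℤ.* E₊ ℤ.- (p ℤ.+ q) ℤ.* (p ℤ.+ q)) ℤ.+ (m ℤ.* E₋ ℤ.- (p ℤ.- q) ℤ.* (p ℤ.- q))
    ≡⟨ ring₁ m E₊ E₋ p q ⟩
  m ℤ.* (E₊ ℤ.+ E₋) ℤ.- (p ℤ.* p ℤ.+ q ℤ.* q) ℤ.- (p ℤ.* p ℤ.+ q ℤ.* q)
    ≡⟨ cong (λ t → m ℤ.* t ℤ.- (p ℤ.* p ℤ.+ q ℤ.* q) ℤ.- (p ℤ.* p ℤ.+ q ℤ.* q)) (form-parallelogram (adjacency G) x y) ⟩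
  m ℤ.* ((Ex ℤ.+ Ey) ℤ.+ (Ex ℤ.+ Ey)) ℤ.- (p ℤ.* p ℤ.+ q ℤ.* q) ℤ.- (p ℤ.* p ℤ.+ q ℤ.* q)
    ≡⟨ ring₂ m Ex Ey p q ⟩
  (centred G x ℤ.+ centred G y) ℤ.+ (centred G x ℤ.+ centred G y) ∎
  where
  open ≡-Reasoning
  m = + total G
  p = moment G x
  q = moment G y
  Ex = energy G x
  Ey = energy G y
  E₊ = energy G (λ i → x i ℤ.+ y i)
  E₋ = energy G (λ i → x i ℤ.- y i)
  ring₀ : ∀ d a b → d ℤ.* (a ℤ.- b) ≡ 1ℤ ℤ.* (d ℤ.* a) ℤ.+ -1ℤ ℤ.* (d ℤ.* b)
  ring₀ = ℤ-Ring.solve-∀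
  ring₀′ : ∀ a b → 1ℤ ℤ.* a ℤ.+ -1ℤ ℤ.* b ≡ a ℤ.- b
  ring₀′ = ℤ-Ring.solve-∀
  plus : moment G (λ i → x i ℤ.+ y i) ≡ p ℤ.+ q
  plus = trans (∑ℤ-cong (λ i → ℤ.*-distribˡ-+ (+ deg G i) (x i) (y i))) (∑ℤ-distrib-+ _ _)
  minus : moment G (λ i → x i ℤ.- y i) ≡ p ℤ.- q
  minus = trans (∑ℤ-cong (λ i → ring₀ (+ deg G i) (x i) (y i))) (trans (∑ℤ-lin 1ℤ -1ℤ _ _) (ring₀′ p q))
  ring₁ : ∀ m e f p q → (m ℤ.* e ℤ.- (p ℤ.+ q) ℤ.* (p ℤ.+ q)) ℤ.+ (m ℤ.* f ℤ.- (p ℤ.- q) ℤ.* (p ℤ.- q))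
        ≡ m ℤ.* (e ℤ.+ f) ℤ.- (p ℤ.* p ℤ.+ q ℤ.* q) ℤ.- (p ℤ.* p ℤ.+ q ℤ.* q)
  ring₁ = ℤ-Ring.solve-∀
  ring₂ : ∀ m e f p q → m ℤ.* ((e ℤ.+ f) ℤ.+ (e ℤ.+ f)) ℤ.- (p ℤ.* p ℤ.+ q ℤ.* q) ℤ.- (p ℤ.* p ℤ.+ q ℤ.* q)
        ≡ ((m ℤ.* e ℤ.- p ℤ.* p) ℤ.+ (m ℤ.* f ℤ.- q ℤ.* q)) ℤ.+ ((m ℤ.* e ℤ.- p ℤ.* p) ℤ.+ (m ℤ.* f ℤ.- q ℤ.* q))
  ring₂ = ℤ-Ring.solve-∀

-- Edges leaving `W` are deleted but the vertex type stays `Fin n`, which avoids reindexing; the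
-- true order of the subgraph is then carried by a separate set of vertices.
restrict : ∀ {n} → Graph n → (Fin n → Bool) → Graph n
restrict G W .adj i j    = (W i ∧ W j) ∧ adj G i j
restrict G W .sym i j    = cong₂ _∧_ (∧-comm (W i) (W j)) (sym G i j)
restrict G W .irrefl i rewrite irrefl G i with W i
... | true  = refl
... | false = refl

energy-restrict : ∀ {n} (G : Graph n) (W : Fin n → Bool) x →
  energy G (λ i → + ⟦ W i ⟧ ℤ.* x i) ≡ energy (restrict G W) x
energy-restrict G W x = ∑ℤ-cong (λ i → ∑ℤ-cong (λ j → entry (W i) (W j) (adj G i j) (x i) (x j)))
  where
  ring : ∀ a b c x y → a ℤ.* x ℤ.* (c ℤ.* (b ℤ.* y)) ≡ x ℤ.* (a ℤ.* b ℤ.* c ℤ.* y)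
  ring = ℤ-Ring.solve-∀
  entry : ∀ a b c x y → + ⟦ a ⟧ ℤ.* x ℤ.* (+ ⟦ c ⟧ ℤ.* (+ ⟦ b ⟧ ℤ.* y)) ≡ x ℤ.* (+ ⟦ (a ∧ b) ∧ c ⟧ ℤ.* y)
  entry a b c x y = trans (ring (+ ⟦ a ⟧) (+ ⟦ b ⟧) (+ ⟦ c ⟧) x y) (cong (λ t → x ℤ.* (t ℤ.* y))
    (trans (cong (ℤ._* + ⟦ c ⟧) (trans (≡-sym (ℤ.pos-* ⟦ a ⟧ ⟦ b ⟧)) (cong +_ (≡-sym (⟦∧⟧ a b)))))
      (trans (≡-sym (ℤ.pos-* ⟦ a ∧ b ⟧ ⟦ c ⟧)) (cong +_ (≡-sym (⟦∧⟧ (a ∧ b) c))))))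

energy-const : ∀ {n} (G : Graph n) → energy G (λ _ → 1ℤ) ≡ + total G
energy-const G = ≡-sym (trans (+-∑ (deg G)) (∑ℤ-cong (λ i → trans (+-∑ _)
  (∑ℤ-cong (λ j → ring (adjacency G i j))))))
  where
  ring : ∀ a → a ≡ 1ℤ ℤ.* (a ℤ.* 1ℤ)
  ring = ℤ-Ring.solve-∀

energy-indicator : ∀ {n} (G : Graph n) (W : Fin n → Bool) → energy G (λ i → + ⟦ W i ⟧) ≡ + total (restrict G W)
energy-indicator G W = trans (form-cong (adjacency G) (λ i → ≡-sym (ℤ.*-identityʳ (+ ⟦ W i ⟧))))
  (trans (energy-restrict G W (λ _ → 1ℤ)) (energy-const (restrict G W)))

moment-indicator : ∀ {n} (G : Graph n) (W : Fin n → Bool) → moment G (λ i → + ⟦ W i ⟧) ≡ + vol G W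
moment-indicator G W = ≡-sym (trans (+-∑ _) (∑ℤ-cong (λ i →
  trans (ℤ.pos-* ⟦ W i ⟧ (deg G i)) (ℤ.*-comm (+ ⟦ W i ⟧) (+ deg G i)))))

∣moment∣≤total : ∀ {n} (G : Graph n) (x : Fin n → ℤ) → (∀ i → ∣ x i ∣ ≤ 1) → ∣ moment G x ∣ ≤ total G
∣moment∣≤total G x x≤1 = ℕ.≤-trans (∣∑∣≤∑∣∣ _) (∑ℕ-mono (λ i → subst₂ _≤_
  (≡-sym (ℤ.abs-* (+ deg G i) (x i))) (ℕ.*-identityʳ (deg G i)) (ℕ.*-monoʳ-≤ (deg G i) (x≤1 i))))

-- Signs minimising the energy pay for subtracting the mean by a factor 4 only, since the shifted entries lie in [-2, 2].
signs-below-centred : ∀ {n} (G : Graph n) (x : Fin n → ℤ) → 0 ℕ.< total G → (∀ i → ∣ x i ∣ ≤ 1) →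
  Σ (Fin n → Bool) λ s → + (4 ℕ.* total G) ℤ.* energy G (σ ∘ s) ℤ.≤ centred G x
signs-below-centred {n} G x 0<m x≤1 = s ,
  ℤ.*-cancelˡ-≤-pos _ _ (+ m) {{ℤ.positive (ℤ.+<+ 0<m)}} (subst₂ ℤ._≤_ (scale (energy G (σ ∘ s))) (energy-shift G x) (proj₂ rounded))
  where
  m = total G
  x′ : Fin n → ℤ
  x′ i = + m ℤ.* x i ℤ.- moment G x
  bound : ∀ i → ∣ x′ i ∣ ≤ m ℕ.+ m
  bound i = ℕ.≤-trans (ℤ.∣i-j∣≤∣i∣+∣j∣ (+ m ℤ.* x i) (moment G x)) (ℕ.+-mono-≤
    (subst₂ _≤_ (≡-sym (ℤ.abs-* (+ m) (x i))) (ℕ.*-identityʳ m) (ℕ.*-monoʳ-≤ m (x≤1 i)))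
    (∣moment∣≤total G x x≤1))
  rounded = rounding (isAdjacency G) x′ (m ℕ.+ m) bound
  s : Fin n → Bool
  s = proj₁ rounded
  ring : ∀ m → (m ℕ.+ m) ℕ.* (m ℕ.+ m) ≡ m ℕ.* (4 ℕ.* m)
  ring = ℕ-Ring.solve-∀
  scale : ∀ E → + (m ℕ.+ m) ℤ.* + (m ℕ.+ m) ℤ.* E ≡ + m ℤ.* (+ (4 ℕ.* m) ℤ.* E)
  scale E = begin
    + (m ℕ.+ m) ℤ.* + (m ℕ.+ m) ℤ.* E        ≡⟨ cong (ℤ._* E) (≡-sym (ℤ.pos-* (m ℕ.+ m) (m ℕ.+ m))) ⟩
    + ((m ℕ.+ m) ℕ.* (m ℕ.+ m)) ℤ.* E        ≡⟨ cong (λ t → + t ℤ.* E) (ring m) ⟩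
    + (m ℕ.* (4 ℕ.* m)) ℤ.* E                ≡⟨ cong (ℤ._* E) (ℤ.pos-* m (4 ℕ.* m)) ⟩
    + m ℤ.* + (4 ℕ.* m) ℤ.* E                ≡⟨ ℤ.*-assoc (+ m) (+ (4 ℕ.* m)) E ⟩
    + m ℤ.* (+ (4 ℕ.* m) ℤ.* E)              ∎
    where open ≡-Reasoning

-- Arithmetic of the dense case and sign lemmas.

^-distribʳ-* : ∀ e a b → (a ℕ.* b) ℕ.^ e ≡ a ℕ.^ e ℕ.* b ℕ.^ e
^-distribʳ-* zero    a b = refl
^-distribʳ-* (suc e) a b = trans (cong ((a ℕ.* b) ℕ.*_) (^-distribʳ-* e a b)) (ring a b (a ℕ.^ e) (b ℕ.^ e))
  where
  ring : ∀ a b c d → a ℕ.* b ℕ.* (c ℕ.* d) ≡ a ℕ.* c ℕ.* (b ℕ.* d)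
  ring = ℕ-Ring.solve-∀

-- Here `w` is the degree sum inside a piece of volume `z` with `k` vertices. The first hypothesis
-- is raised to the power `suc e` to meet the bound on `w`; a factor m^(2e) then turns k^(2e) into
-- (2Nz)^(2e), and z^(2e) m^e cancels. The constant is 2^(e+1) from the first hypothesis times 4^e
-- from the second.
gain-arithmetic : ∀ e {z m N w k K g} → 0 ℕ.< z → 0 ℕ.< m →
  z ℕ.* z ≤ 2 ℕ.* m ℕ.* w → m ℕ.* k ≤ 2 ℕ.* N ℕ.* z →
  w ℕ.^ suc e ≤ K ℕ.* (g ℕ.* (k ℕ.* k) ℕ.^ e) →
  z ℕ.* z ℕ.* m ℕ.^ e ≤ 2 ℕ.* 8 ℕ.^ e ℕ.* K ℕ.* ((N ℕ.* N) ℕ.^ e ℕ.* (m ℕ.* g))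
gain-arithmetic e {z@(suc _)} {m@(suc _)} {N} {w} {k} {K} {g} _ _ z²≤2mw mk≤2Nz w≤ =
  ℕ.*-cancelʳ-≤ _ _ (Z ℕ.* Y) {{ℕ.m*n≢0 Z Y {{ℕ.m^n≢0 (z ℕ.* z) e}} {{ℕ.m^n≢0 m e}}}} (begin
  z ℕ.* z ℕ.* Y ℕ.* (Z ℕ.* Y)
    ≡⟨ r₁ (z ℕ.* z) Y Z ⟩
  (z ℕ.* z) ℕ.^ suc e ℕ.* (Y ℕ.* Y)
    ≤⟨ ℕ.*-monoˡ-≤ (Y ℕ.* Y) (ℕ.^-monoˡ-≤ (suc e) z²≤2mw) ⟩
  (2 ℕ.* m ℕ.* w) ℕ.^ suc e ℕ.* (Y ℕ.* Y)
    ≡⟨ cong (ℕ._* (Y ℕ.* Y)) (trans (^-distribʳ-* (suc e) (2 ℕ.* m) w) (cong (λ t → 2 ℕ.* m ℕ.* t ℕ.* w ℕ.^ suc e) (^-distribʳ-* e 2 m))) ⟩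
  2 ℕ.* m ℕ.* (2 ℕ.^ e ℕ.* Y) ℕ.* w ℕ.^ suc e ℕ.* (Y ℕ.* Y)
    ≤⟨ ℕ.*-monoˡ-≤ (Y ℕ.* Y) (ℕ.*-monoʳ-≤ (2 ℕ.* m ℕ.* (2 ℕ.^ e ℕ.* Y)) w≤) ⟩
  2 ℕ.* m ℕ.* (2 ℕ.^ e ℕ.* Y) ℕ.* (K ℕ.* (g ℕ.* (k ℕ.* k) ℕ.^ e)) ℕ.* (Y ℕ.* Y)
    ≡⟨ r₂ m (2 ℕ.^ e) Y K g ((k ℕ.* k) ℕ.^ e) ⟩
  2 ℕ.* m ℕ.* 2 ℕ.^ e ℕ.* Y ℕ.* K ℕ.* g ℕ.* (Y ℕ.* Y ℕ.* (k ℕ.* k) ℕ.^ e)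
    ≡⟨ cong (2 ℕ.* m ℕ.* 2 ℕ.^ e ℕ.* Y ℕ.* K ℕ.* g ℕ.*_) collect ⟩
  2 ℕ.* m ℕ.* 2 ℕ.^ e ℕ.* Y ℕ.* K ℕ.* g ℕ.* (m ℕ.* k ℕ.* (m ℕ.* k)) ℕ.^ e
    ≤⟨ ℕ.*-monoʳ-≤ (2 ℕ.* m ℕ.* 2 ℕ.^ e ℕ.* Y ℕ.* K ℕ.* g) (ℕ.^-monoˡ-≤ e (ℕ.*-mono-≤ mk≤2Nz mk≤2Nz)) ⟩
  2 ℕ.* m ℕ.* 2 ℕ.^ e ℕ.* Y ℕ.* K ℕ.* g ℕ.* (2 ℕ.* N ℕ.* z ℕ.* (2 ℕ.* N ℕ.* z)) ℕ.^ e
    ≡⟨ cong (2 ℕ.* m ℕ.* 2 ℕ.^ e ℕ.* Y ℕ.* K ℕ.* g ℕ.*_) spread ⟩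
  2 ℕ.* m ℕ.* 2 ℕ.^ e ℕ.* Y ℕ.* K ℕ.* g ℕ.* (4 ℕ.^ e ℕ.* ((N ℕ.* N) ℕ.^ e ℕ.* Z))
    ≡⟨ r₃ m (2 ℕ.^ e) Y K g (4 ℕ.^ e) ((N ℕ.* N) ℕ.^ e) Z ⟩
  2 ℕ.* (2 ℕ.^ e ℕ.* 4 ℕ.^ e) ℕ.* K ℕ.* ((N ℕ.* N) ℕ.^ e ℕ.* (m ℕ.* g)) ℕ.* (Z ℕ.* Y)
    ≡⟨ cong (λ t → 2 ℕ.* t ℕ.* K ℕ.* ((N ℕ.* N) ℕ.^ e ℕ.* (m ℕ.* g)) ℕ.* (Z ℕ.* Y)) (≡-sym (^-distribʳ-* e 2 4)) ⟩
  2 ℕ.* 8 ℕ.^ e ℕ.* K ℕ.* ((N ℕ.* N) ℕ.^ e ℕ.* (m ℕ.* g)) ℕ.* (Z ℕ.* Y) ∎)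
  where
  open ℕ.≤-Reasoning
  Z = (z ℕ.* z) ℕ.^ e
  Y = m ℕ.^ e
  r₁ : ∀ s y t → s ℕ.* y ℕ.* (t ℕ.* y) ≡ s ℕ.* t ℕ.* (y ℕ.* y)
  r₁ = ℕ-Ring.solve-∀
  r₂ : ∀ m a y K g q → 2 ℕ.* m ℕ.* (a ℕ.* y) ℕ.* (K ℕ.* (g ℕ.* q)) ℕ.* (y ℕ.* y) ≡ 2 ℕ.* m ℕ.* a ℕ.* y ℕ.* K ℕ.* g ℕ.* (y ℕ.* y ℕ.* q)
  r₂ = ℕ-Ring.solve-∀
  r₃ : ∀ m a y K g f n z → 2 ℕ.* m ℕ.* a ℕ.* y ℕ.* K ℕ.* g ℕ.* (f ℕ.* (n ℕ.* z)) ≡ 2 ℕ.* (a ℕ.* f) ℕ.* K ℕ.* (n ℕ.* (m ℕ.* g)) ℕ.* (z ℕ.* y)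
  r₃ = ℕ-Ring.solve-∀
  square : ∀ a b → a ℕ.* b ℕ.* (a ℕ.* b) ≡ a ℕ.* a ℕ.* (b ℕ.* b)
  square = ℕ-Ring.solve-∀
  collect : Y ℕ.* Y ℕ.* (k ℕ.* k) ℕ.^ e ≡ (m ℕ.* k ℕ.* (m ℕ.* k)) ℕ.^ e
  collect = trans (cong (ℕ._* (k ℕ.* k) ℕ.^ e) (≡-sym (^-distribʳ-* e m m)))
    (trans (≡-sym (^-distribʳ-* e (m ℕ.* m) (k ℕ.* k))) (cong (ℕ._^ e) (≡-sym (square m k))))
  quadruple : ∀ N z → 2 ℕ.* N ℕ.* z ℕ.* (2 ℕ.* N ℕ.* z) ≡ 4 ℕ.* (N ℕ.* N ℕ.* (z ℕ.* z))
  quadruple = ℕ-Ring.solve-∀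
  spread : (2 ℕ.* N ℕ.* z ℕ.* (2 ℕ.* N ℕ.* z)) ℕ.^ e ≡ 4 ℕ.^ e ℕ.* ((N ℕ.* N) ℕ.^ e ℕ.* Z)
  spread = trans (cong (ℕ._^ e) (quadruple N z)) (trans (^-distribʳ-* e 4 (N ℕ.* N ℕ.* (z ℕ.* z)))
    (cong (4 ℕ.^ e ℕ.*_) (^-distribʳ-* e (N ℕ.* N) (z ℕ.* z))))

0≤i*i : ∀ i → 0ℤ ℤ.≤ i ℤ.* i
0≤i*i (+ n)    = subst (0ℤ ℤ.≤_) (ℤ.pos-* n n) (ℤ.+≤+ ℕ.z≤n)
0≤i*i -[1+ n ] = ℤ.+≤+ ℕ.z≤n

i-j≤i : ∀ i j → 0ℤ ℤ.≤ j → i ℤ.- j ℤ.≤ i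
i-j≤i i j 0≤j = subst (i ℤ.- j ℤ.≤_) (ℤ.+-identityʳ i) (ℤ.+-monoʳ-≤ i (ℤ.neg-mono-≤ 0≤j))

centred≤energy : ∀ {n} (G : Graph n) (x : Fin n → ℤ) → centred G x ℤ.≤ + total G ℤ.* energy G x
centred≤energy G x = i-j≤i _ _ (0≤i*i (moment G x))

centred-0≤0 : ∀ {n} (G : Graph n) → centred G (λ _ → 0ℤ) ℤ.≤ 0ℤ
centred-0≤0 G = subst (centred G (λ _ → 0ℤ) ℤ.≤_)
  (trans (cong (+ total G ℤ.*_) (form-scale (adjacency G) 0ℤ (λ _ → 1ℤ))) (ℤ.*-zeroʳ (+ total G)))
  (centred≤energy G (λ _ → 0ℤ))

-- Two numbers with mean `c` cannot both exceed it. With the parallelogram law this chooses the sign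
-- of each new piece.
either≤ : ∀ {a b c} → a ℤ.+ b ≡ c ℤ.+ c → a ℤ.≤ c ⊎ b ℤ.≤ c
either≤ {a} {b} {c} eq with a ℤ.≤? c | b ℤ.≤? c
... | yes a≤c | _       = inj₁ a≤c
... | no  _   | yes b≤c = inj₂ b≤c
... | no  a≰c | no  b≰c = ⊥-elim (ℤ.<-irrefl (≡-sym eq) (ℤ.+-mono-< (ℤ.≰⇒> a≰c) (ℤ.≰⇒> b≰c)))

-- Since `a` is positive, `E` cannot be; its absolute value serves as `g`, which brings the estimate
-- back to naturals.
neg-energy : ∀ a h E → 0 ℕ.< a → + a ℤ.* E ℤ.≤ ℤ.- + h → ∃[ g ] (+ g ℤ.≤ ℤ.- E × h ≤ a ℕ.* g)
neg-energy (suc a) h (+ zero) _ le = 0 , ℤ.≤-refl , ℤ.drop‿+≤+ (ℤ.neg-cancel-≤ (subst (ℤ._≤ ℤ.- + h) (trans (ℤ.*-zeroʳ (+ suc a)) (cong (λ k → ℤ.- + k) (≡-sym (ℕ.*-zeroʳ a)))) le))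
neg-energy (suc a) zero    (+ suc k) _ (ℤ.+≤+ ())
neg-energy (suc a) (suc h) (+ suc k) _ ()
neg-energy a h -[1+ k ] _ le = suc k , ℤ.≤-refl , ℤ.drop‿+≤+ (ℤ.neg-cancel-≤ (subst (ℤ._≤ ℤ.- + h) eq le))
  where
  eq : + a ℤ.* -[1+ k ] ≡ ℤ.- + (a ℕ.* suc k)
  eq = trans (≡-sym (ℤ.neg-distribʳ-* (+ a) (+ suc k))) (cong ℤ.-_ (≡-sym (ℤ.pos-* a (suc k))))

-- The inductive statement, its base case and neighbourhoods.

-- For r = 2 + e and m = n d, the quotient d^(r-1) / n^(r-3) is m^(1+e) / n^(2e), and minus the energy of signs is four
-- times their surplus. The role of n is played by the size of a set U that contains all non-isolated vertices.
SurplusBound : ℕ → ℕ → Set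
SurplusBound e K = ∀ {n} (G : Graph n) (U : Fin n → Bool) → (∀ i j → T (adj G i j) → T (U i)) → KrFree (2 ℕ.+ e) G →
  Σ (Fin n → Bool) λ s → ∃[ g ]
    (total G ℕ.^ suc e ≤ K ℕ.* (g ℕ.* (size U ℕ.* size U) ℕ.^ e) × + g ℤ.≤ ℤ.- energy G (σ ∘ s))

edgeless⇒0≤-energy : ∀ {n} (G : Graph n) → total G ≡ 0 → 0ℤ ℤ.≤ ℤ.- energy G (λ _ → 1ℤ)
edgeless⇒0≤-energy G m≡0 = ℤ.≤-reflexive (≡-sym (cong ℤ.-_ (trans (energy-const G) (cong +_ m≡0))))

K₂-free⇒edgeless : ∀ {n} (G : Graph n) → KrFree 2 G → total G ≡ 0
K₂-free⇒edgeless {n} G free = ∑ℕ-zero _ (λ i → ∑ℕ-zero _ (λ j → no-edge i j))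
  where
  pair : Fin n → Fin n → Fin 2 → Fin n
  pair i j zero    = i
  pair i j (suc _) = j
  no-edge : ∀ i j → ⟦ adj G i j ⟧ ≡ 0
  no-edge i j with adj G i j in eq
  ... | false = refl
  ... | true  = ⊥-elim (free (pair i j) clique)
    where
    clique : ∀ a b → a ≢ b → T (adj G (pair i j a) (pair i j b))
    clique zero       zero       a≢b = ⊥-elim (a≢b refl)
    clique zero       (suc zero) _   = subst T (≡-sym eq) tt
    clique (suc zero) zero       _   = subst T (≡-sym (trans (sym G j i) eq)) tt
    clique (suc zero) (suc zero) a≢b = ⊥-elim (a≢b refl)

neighbours : ∀ {n} → Graph n → Fin n → (Fin n → Bool) → Fin n → Bool
neighbours G v R i = adj G v i ∧ R i

non-neighbours : ∀ {n} → Graph n → Fin n → (Fin n → Bool) → Fin n → Bool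
non-neighbours G v R i = not (adj G v i) ∧ R i

neighbours-free : ∀ {n} (G : Graph n) v (R : Fin n → Bool) e → KrFree (3 ℕ.+ e) G → KrFree (2 ℕ.+ e) (restrict G (neighbours G v R))
neighbours-free {n} G v R e free f clique = free f′ clique′
  where
  open Equivalence
  f′ : Fin (3 ℕ.+ e) → Fin n
  f′ zero    = v
  f′ (suc i) = f i
  -- Vertices outside the neighbourhood survive as isolated ones, so membership has to be read off
  -- an edge. A clique on at least two vertices supplies one at every vertex.
  other : ∀ (i : Fin (2 ℕ.+ e)) → ∃[ j ] i ≢ j
  other zero    = suc zero , λ ()
  other (suc i) = zero , λ ()
  adjacent : ∀ i → T (adj G v (f i))
  adjacent i with other i
  ... | j , i≢j = proj₁ (to T-∧ (proj₁ (to (T-∧ {neighbours G v R (f i)}) (proj₁ (to T-∧ (clique i j i≢j))))))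
  clique′ : ∀ i j → i ≢ j → T (adj G (f′ i) (f′ j))
  clique′ zero    zero    i≢j = ⊥-elim (i≢j refl)
  clique′ zero    (suc j) _   = adjacent j
  clique′ (suc i) zero    _   = subst T (sym G v (f i)) (adjacent i)
  clique′ (suc i) (suc j) i≢j = proj₂ (to (T-∧ {neighbours G v R (f i) ∧ neighbours G v R (f j)}) (clique i j (i≢j ∘ cong suc)))

-- Were `f v` below `b` throughout `U`, each vertex of `U` would lose at least 1, so the sum would
-- fall short of `size U` times `b` by at least `size U`. The average is over `U` and not over
-- `Fin n`, so that only `size U` enters the bounds.
pigeonhole : ∀ {n} (U : Fin n → Bool) (f : Fin n → ℕ) b → (∀ v → ¬ T (U v) → f v ≡ 0) →
  0 ℕ.< size U → size U ℕ.* b ≤ ∑ℕ f → ∃[ v ] b ≤ f v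
pigeonhole U f b off 0<N large with Fin.any? (λ v → b ℕ.≤? f v)
... | yes found = found
... | no  none  = ⊥-elim (ℕ.<⇒≱ 0<N (ℕ.+-cancelʳ-≤ (∑ℕ f) (size U) 0 (ℕ.≤-trans small large)))
  where
  pointwise : ∀ v → ⟦ U v ⟧ ℕ.+ f v ≤ b ℕ.* ⟦ U v ⟧
  pointwise v with U v in eq
  ... | true  = subst (suc (f v) ≤_) (≡-sym (ℕ.*-identityʳ b)) (ℕ.≰⇒> (λ b≤f → none (v , b≤f)))
  ... | false = subst (f v ≤_) (≡-sym (ℕ.*-zeroʳ b)) (ℕ.≤-reflexive (off v (subst T eq)))
  small : size U ℕ.+ ∑ℕ f ≤ size U ℕ.* b
  small = subst₂ _≤_ (∑ℕ-distrib-+ (λ v → ⟦ U v ⟧) f)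
    (trans (≡-sym (*-distribˡ-∑ℕ b (λ v → ⟦ U v ⟧))) (ℕ.*-comm b (size U))) (∑ℕ-mono pointwise)

-- Vertices of high degree.

⟦adj⟧≤ : ∀ {n} (G : Graph n) (U : Fin n → Bool) → (∀ i j → T (adj G i j) → T (U i)) → ∀ i j → ⟦ adj G i j ⟧ ≤ ⟦ U i ⟧ ℕ.* ⟦ U j ⟧
⟦adj⟧≤ G U supp i j = subst (⟦ adj G i j ⟧ ≤_) (⟦∧⟧ (U i) (U j))
  (⟦⟧-mono (λ e → Equivalence.from T-∧ (supp i j e , supp j i (subst T (sym G i j) e))))

deg≤ : ∀ {n} (G : Graph n) (U : Fin n → Bool) → (∀ i j → T (adj G i j) → T (U i)) → ∀ i → deg G i ≤ size U ℕ.* ⟦ U i ⟧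
deg≤ G U supp i = ℕ.≤-trans (∑ℕ-mono (⟦adj⟧≤ G U supp i))
  (ℕ.≤-reflexive (trans (≡-sym (*-distribˡ-∑ℕ ⟦ U i ⟧ (λ j → ⟦ U j ⟧))) (ℕ.*-comm ⟦ U i ⟧ (size U))))

total≤size² : ∀ {n} (G : Graph n) (U : Fin n → Bool) → (∀ i j → T (adj G i j) → T (U i)) → total G ≤ size U ℕ.* size U
total≤size² G U supp = ℕ.≤-trans (∑ℕ-mono (deg≤ G U supp)) (ℕ.≤-reflexive (≡-sym (*-distribˡ-∑ℕ (size U) (λ i → ⟦ U i ⟧))))

-- At least half of the average degree over `N` vertices, with denominators cleared.
heavy : ∀ {n} → Graph n → ℕ → Fin n → Bool
heavy G N i = total G ℕ.≤ᵇ 2 ℕ.* N ℕ.* deg G i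

-- At most `N` vertices have an edge, and each light one has degree below m/2N, so the light ones
-- account for at most half of the degree sum.
total≤2vol-heavy : ∀ {n} (G : Graph n) (U : Fin n → Bool) → (∀ i j → T (adj G i j) → T (U i)) → 0 ℕ.< size U →
  total G ≤ 2 ℕ.* vol G (heavy G (size U))
total≤2vol-heavy {n} G U supp 0<N = ℕ.*-cancelˡ-≤ N {{ℕ.>-nonZero 0<N}}
  (ℕ.+-cancelˡ-≤ (N ℕ.* m) _ _ (subst₂ _≤_ eqˡ eqʳ (∑ℕ-mono pointwise)))
  where
  N = size U
  m = total G
  H = heavy G N
  split : ∀ x → x ≤ m ℕ.+ ⟦ m ℕ.≤ᵇ x ⟧ ℕ.* x
  split x with m ℕ.≤ᵇ x in eq
  ... | true  = ℕ.≤-trans (ℕ.≤-reflexive (≡-sym (ℕ.*-identityˡ x))) (ℕ.m≤n+m (1 ℕ.* x) m)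
  ... | false = ℕ.≤-trans (ℕ.<⇒≤ (ℕ.≰⇒> (λ m≤x → subst T eq (ℕ.≤⇒≤ᵇ m≤x)))) (ℕ.m≤m+n m 0)
  pointwise : ∀ i → 2 ℕ.* N ℕ.* deg G i ≤ m ℕ.* ⟦ U i ⟧ ℕ.+ 2 ℕ.* N ℕ.* (⟦ H i ⟧ ℕ.* deg G i)
  pointwise i with U i | deg≤ G U supp i
  ... | true  | _    = ℕ.≤-trans (split (2 ℕ.* N ℕ.* deg G i)) (ℕ.≤-reflexive (ring m ⟦ H i ⟧ N (deg G i)))
    where
    ring : ∀ m h N d → m ℕ.+ h ℕ.* (2 ℕ.* N ℕ.* d) ≡ m ℕ.* 1 ℕ.+ 2 ℕ.* N ℕ.* (h ℕ.* d)
    ring = ℕ-Ring.solve-∀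
  ... | false | d≤0 = ℕ.≤-trans (ℕ.≤-reflexive (trans (cong (2 ℕ.* N ℕ.*_) d≡0) (ℕ.*-zeroʳ (2 ℕ.* N)))) ℕ.z≤n
    where
    d≡0 : deg G i ≡ 0
    d≡0 = ℕ.n≤0⇒n≡0 (subst (deg G i ≤_) (ℕ.*-zeroʳ N) d≤0)
  eqˡ : ∑ℕ (λ i → 2 ℕ.* N ℕ.* deg G i) ≡ N ℕ.* m ℕ.+ N ℕ.* m
  eqˡ = trans (≡-sym (*-distribˡ-∑ℕ (2 ℕ.* N) (deg G))) (ring N m)
    where
    ring : ∀ N m → 2 ℕ.* N ℕ.* m ≡ N ℕ.* m ℕ.+ N ℕ.* m
    ring = ℕ-Ring.solve-∀
  eqʳ : ∑ℕ (λ i → m ℕ.* ⟦ U i ⟧ ℕ.+ 2 ℕ.* N ℕ.* (⟦ H i ⟧ ℕ.* deg G i)) ≡ N ℕ.* m ℕ.+ N ℕ.* (2 ℕ.* vol G H)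
  eqʳ = trans (∑ℕ-distrib-+ _ _) (cong₂ ℕ._+_
    (trans (≡-sym (*-distribˡ-∑ℕ m (λ i → ⟦ U i ⟧))) (ℕ.*-comm m N))
    (trans (≡-sym (*-distribˡ-∑ℕ (2 ℕ.* N) (λ i → ⟦ H i ⟧ ℕ.* deg G i))) (ring N (vol G H))))
    where
    ring : ∀ N v → 2 ℕ.* N ℕ.* v ≡ N ℕ.* (2 ℕ.* v)
    ring = ℕ-Ring.solve-∀

-- The gain on one neighbourhood, sparse or dense.

-- With z the volume of `W`, the inequality reads g ≥ z² (m/N²)^e / (2 · 8^e K). The bound on `x`
-- says at once that its entries lie in [-1,1] and that it vanishes outside `W`.
Gain : ∀ {n} → Graph n → ℕ → ℕ → ℕ → (Fin n → Bool) → Set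
Gain {n} G N e K W = Σ (Fin n → ℤ) λ x → (∀ i → ∣ x i ∣ ≤ ⟦ W i ⟧) × ∃[ g ]
  (vol G W ℕ.* vol G W ℕ.* total G ℕ.^ e ≤ 2 ℕ.* 8 ℕ.^ e ℕ.* K ℕ.* ((N ℕ.* N) ℕ.^ e ℕ.* g) × + g ℤ.≤ ℤ.- centred G x)

-- The indicator gives z² - mw ≥ z²/2. The factors (m/N²)^e ≤ 1 and 1/(8^e K) ≤ 1 are given away to
-- match the dense case.
sparse-gain : ∀ {n} (G : Graph n) (W : Fin n → Bool) N e K → 0 ℕ.< K → total G ≤ N ℕ.* N →
  2 ℕ.* total G ℕ.* total (restrict G W) ≤ vol G W ℕ.* vol G W → Gain G N e K W
sparse-gain G W N e K 0<K m≤N² sparse = (λ i → + ⟦ W i ⟧) , (λ _ → ℕ.≤-refl) , g , large , ℤ.≤-reflexive value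
  where
  m = total G
  w = total (restrict G W)
  z = vol G W
  g = z ℕ.* z ∸ m ℕ.* w
  sparse′ : m ℕ.* w ℕ.+ m ℕ.* w ≤ z ℕ.* z
  sparse′ = subst (_≤ z ℕ.* z) (ring m w) sparse
    where
    ring : ∀ m w → 2 ℕ.* m ℕ.* w ≡ m ℕ.* w ℕ.+ m ℕ.* w
    ring = ℕ-Ring.solve-∀
  mw≤z² : m ℕ.* w ≤ z ℕ.* z
  mw≤z² = ℕ.≤-trans (ℕ.m≤m+n (m ℕ.* w) (m ℕ.* w)) sparse′
  value : + g ≡ ℤ.- centred G (λ i → + ⟦ W i ⟧)
  value = begin
    + g                                ≡⟨ ≡-sym (ℤ.⊖-≥ mw≤z²) ⟩
    z ℕ.* z ℤ.⊖ m ℕ.* w                ≡⟨ ≡-sym (ℤ.m-n≡m⊖n (z ℕ.* z) (m ℕ.* w)) ⟩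
    + (z ℕ.* z) ℤ.- + (m ℕ.* w)        ≡⟨ cong₂ ℤ._-_ (ℤ.pos-* z z) (ℤ.pos-* m w) ⟩
    + z ℤ.* + z ℤ.- + m ℤ.* + w        ≡⟨ ring (+ z) (+ m) (+ w) ⟩
    ℤ.- (+ m ℤ.* + w ℤ.- + z ℤ.* + z)  ≡⟨ cong₂ (λ a b → ℤ.- (+ m ℤ.* a ℤ.- b ℤ.* b)) (≡-sym (energy-indicator G W)) (≡-sym (moment-indicator G W)) ⟩
    ℤ.- centred G (λ i → + ⟦ W i ⟧)    ∎
    where
    open ≡-Reasoning
    ring : ∀ z m w → z ℤ.* z ℤ.- m ℤ.* w ≡ ℤ.- (m ℤ.* w ℤ.- z ℤ.* z)
    ring = ℤ-Ring.solve-∀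
  z²≤2g : z ℕ.* z ≤ 2 ℕ.* g
  z²≤2g = ℕ.+-cancelʳ-≤ (m ℕ.* w ℕ.+ m ℕ.* w) _ _ (begin
    z ℕ.* z ℕ.+ (m ℕ.* w ℕ.+ m ℕ.* w)  ≤⟨ ℕ.+-monoʳ-≤ (z ℕ.* z) sparse′ ⟩
    z ℕ.* z ℕ.+ z ℕ.* z                ≡⟨ cong (λ t → t ℕ.+ t) (≡-sym (ℕ.m∸n+n≡m mw≤z²)) ⟩
    (g ℕ.+ m ℕ.* w) ℕ.+ (g ℕ.+ m ℕ.* w) ≡⟨ ring g (m ℕ.* w) ⟩
    2 ℕ.* g ℕ.+ (m ℕ.* w ℕ.+ m ℕ.* w)  ∎)
    where
    open ℕ.≤-Reasoning
    ring : ∀ g a → (g ℕ.+ a) ℕ.+ (g ℕ.+ a) ≡ 2 ℕ.* g ℕ.+ (a ℕ.+ a)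
    ring = ℕ-Ring.solve-∀
  instance
    K≢0 = ℕ.>-nonZero 0<K
    8^e≢0 = ℕ.m^n≢0 8 e
    8^eK≢0 = ℕ.m*n≢0 (8 ℕ.^ e) K
  large : z ℕ.* z ℕ.* m ℕ.^ e ≤ 2 ℕ.* 8 ℕ.^ e ℕ.* K ℕ.* ((N ℕ.* N) ℕ.^ e ℕ.* g)
  large = begin
    z ℕ.* z ℕ.* m ℕ.^ e                                    ≤⟨ ℕ.*-mono-≤ z²≤2g (ℕ.^-monoˡ-≤ e m≤N²) ⟩
    2 ℕ.* g ℕ.* (N ℕ.* N) ℕ.^ e                            ≤⟨ ℕ.m≤n*m _ (8 ℕ.^ e ℕ.* K) ⟩
    8 ℕ.^ e ℕ.* K ℕ.* (2 ℕ.* g ℕ.* (N ℕ.* N) ℕ.^ e)        ≡⟨ ring (8 ℕ.^ e) K g ((N ℕ.* N) ℕ.^ e) ⟩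
    2 ℕ.* 8 ℕ.^ e ℕ.* K ℕ.* ((N ℕ.* N) ℕ.^ e ℕ.* g)        ∎
    where
    open ℕ.≤-Reasoning
    ring : ∀ a K g q → a ℕ.* K ℕ.* (2 ℕ.* g ℕ.* q) ≡ 2 ℕ.* a ℕ.* K ℕ.* (q ℕ.* g)
    ring = ℕ-Ring.solve-∀

-- The signs on `W` are extended by zero. Their moment is not controlled, but its square enters the
-- centred form with a minus sign and can only help.
dense-gain : ∀ {n} (G : Graph n) (W : Fin n → Bool) N e K → 0 ℕ.< total G → 0 ℕ.< vol G W →
  total G ℕ.* size W ≤ 2 ℕ.* N ℕ.* vol G W →
  vol G W ℕ.* vol G W ≤ 2 ℕ.* total G ℕ.* total (restrict G W) →
  ∀ s g → total (restrict G W) ℕ.^ suc e ≤ K ℕ.* (g ℕ.* (size W ℕ.* size W) ℕ.^ e) →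
  + g ℤ.≤ ℤ.- energy (restrict G W) (σ ∘ s) → Gain G N e K W
dense-gain {n} G W N e K 0<m 0<z size≤ dense s g g-large g≤ =
  x , ∣x∣≤ , total G ℕ.* g , gain-arithmetic e {N = N} 0<z 0<m dense size≤ g-large , (begin
  + (m ℕ.* g)                                    ≡⟨ ℤ.pos-* m g ⟩
  + m ℤ.* + g                                    ≤⟨ ℤ.*-monoˡ-≤-nonNeg (+ m) g≤ ⟩
  + m ℤ.* (ℤ.- energy (restrict G W) (σ ∘ s))    ≡⟨ cong (λ t → + m ℤ.* (ℤ.- t)) (≡-sym (energy-restrict G W (σ ∘ s))) ⟩
  + m ℤ.* (ℤ.- energy G x)                       ≡⟨ ≡-sym (ℤ.neg-distribʳ-* (+ m) (energy G x)) ⟩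
  ℤ.- (+ m ℤ.* energy G x)                       ≤⟨ ℤ.neg-mono-≤ (centred≤energy G x) ⟩
  ℤ.- centred G x                                ∎)
  where
  open ℤ.≤-Reasoning
  m = total G
  x : Fin n → ℤ
  x i = + ⟦ W i ⟧ ℤ.* σ (s i)
  ∣σ∣ : ∀ b → ∣ σ b ∣ ≡ 1
  ∣σ∣ true  = refl
  ∣σ∣ false = refl
  ∣x∣≤ : ∀ i → ∣ x i ∣ ≤ ⟦ W i ⟧
  ∣x∣≤ i = ℕ.≤-reflexive (trans (ℤ.abs-* (+ ⟦ W i ⟧) (σ (s i))) (trans (cong (⟦ W i ⟧ ℕ.*_) (∣σ∣ (s i))) (ℕ.*-identityʳ ⟦ W i ⟧)))

size-heavy : ∀ {n} (G : Graph n) (W : Fin n → Bool) c → (∀ i → T (W i) → total G ≤ c ℕ.* deg G i) → total G ℕ.* size W ≤ c ℕ.* vol G W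
size-heavy G W c W-heavy = subst₂ _≤_ (≡-sym (*-distribˡ-∑ℕ (total G) (λ i → ⟦ W i ⟧)))
  (≡-sym (*-distribˡ-∑ℕ c (λ i → ⟦ W i ⟧ ℕ.* deg G i))) (∑ℕ-mono pointwise)
  where
  pointwise : ∀ i → total G ℕ.* ⟦ W i ⟧ ≤ c ℕ.* (⟦ W i ⟧ ℕ.* deg G i)
  pointwise i with W i | W-heavy i
  ... | true  | d≥ = subst₂ _≤_ (≡-sym (ℕ.*-identityʳ (total G))) (cong (c ℕ.*_) (≡-sym (ℕ.*-identityˡ (deg G i)))) (d≥ tt)
  ... | false | _  = ℕ.≤-reflexive (trans (ℕ.*-zeroʳ (total G)) (≡-sym (ℕ.*-zeroʳ c)))

-- Finding a neighbourhood of large volume.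

-- Double counting: a vertex of `R` is met by as many neighbourhoods as its degree.
∑-vol-neighbours : ∀ {n} (G : Graph n) (R : Fin n → Bool) →
  ∑ℕ (λ v → vol G (neighbours G v R)) ≡ ∑ℕ (λ i → ⟦ R i ⟧ ℕ.* (deg G i ℕ.* deg G i))
∑-vol-neighbours G R = trans (∑ℕ-comm _) (∑ℕ-cong (λ i → begin
  ∑ℕ (λ v → ⟦ adj G v i ∧ R i ⟧ ℕ.* deg G i)           ≡⟨ ∑ℕ-cong (λ v → entry v i) ⟩
  ∑ℕ (λ v → ⟦ R i ⟧ ℕ.* deg G i ℕ.* ⟦ adj G i v ⟧)     ≡⟨ ≡-sym (*-distribˡ-∑ℕ (⟦ R i ⟧ ℕ.* deg G i) (λ v → ⟦ adj G i v ⟧)) ⟩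
  ⟦ R i ⟧ ℕ.* deg G i ℕ.* deg G i                      ≡⟨ ℕ.*-assoc ⟦ R i ⟧ (deg G i) (deg G i) ⟩
  ⟦ R i ⟧ ℕ.* (deg G i ℕ.* deg G i)                    ∎))
  where
  open ≡-Reasoning
  ring : ∀ a r d → a ℕ.* r ℕ.* d ≡ r ℕ.* d ℕ.* a
  ring = ℕ-Ring.solve-∀
  entry : ∀ v i → ⟦ adj G v i ∧ R i ⟧ ℕ.* deg G i ≡ ⟦ R i ⟧ ℕ.* deg G i ℕ.* ⟦ adj G i v ⟧
  entry v i = trans (cong (ℕ._* deg G i) (⟦∧⟧ (adj G v i) (R i)))
    (trans (ring ⟦ adj G v i ⟧ ⟦ R i ⟧ (deg G i)) (cong (λ b → ⟦ R i ⟧ ℕ.* deg G i ℕ.* ⟦ b ⟧) (sym G v i)))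

-- The volumes of the neighbourhoods within `R` sum to Σ d_i² over `R`, at least (m/2N) · (m/4).
-- Averaging over the `N` vertices of `U` gives m²/8N².
voluminous-neighbourhood : ∀ {n} (G : Graph n) (U : Fin n → Bool) → (∀ i j → T (adj G i j) → T (U i)) → 0 ℕ.< size U →
  ∀ (R : Fin n → Bool) → (∀ i → T (R i) → total G ≤ 2 ℕ.* size U ℕ.* deg G i) → total G ≤ 4 ℕ.* vol G R →
  ∃[ v ] total G ℕ.* total G ≤ 8 ℕ.* (size U ℕ.* size U) ℕ.* vol G (neighbours G v R)
voluminous-neighbourhood G U supp 0<N R R-heavy m≤4r =
  pigeonhole U (λ v → 8 ℕ.* (N ℕ.* N) ℕ.* vol G (neighbours G v R)) (m ℕ.* m) off 0<N (begin
  N ℕ.* (m ℕ.* m)                     ≤⟨ ℕ.*-monoʳ-≤ N (ℕ.*-monoʳ-≤ m m≤4r) ⟩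
  N ℕ.* (m ℕ.* (4 ℕ.* vol G R))       ≡⟨ r₁ N m (vol G R) ⟩
  N ℕ.* (4 ℕ.* (m ℕ.* vol G R))       ≤⟨ ℕ.*-monoʳ-≤ N (ℕ.*-monoʳ-≤ 4 average) ⟩
  N ℕ.* (4 ℕ.* (2 ℕ.* N ℕ.* S))       ≡⟨ r₂ N S ⟩
  8 ℕ.* (N ℕ.* N) ℕ.* S               ≡⟨ *-distribˡ-∑ℕ (8 ℕ.* (N ℕ.* N)) _ ⟩
  ∑ℕ (λ v → 8 ℕ.* (N ℕ.* N) ℕ.* vol G (neighbours G v R)) ∎)
  where
  open ℕ.≤-Reasoning
  N = size U
  m = total G
  S = ∑ℕ (λ v → vol G (neighbours G v R))
  r₁ : ∀ N m r → N ℕ.* (m ℕ.* (4 ℕ.* r)) ≡ N ℕ.* (4 ℕ.* (m ℕ.* r))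
  r₁ = ℕ-Ring.solve-∀
  r₂ : ∀ N S → N ℕ.* (4 ℕ.* (2 ℕ.* N ℕ.* S)) ≡ 8 ℕ.* (N ℕ.* N) ℕ.* S
  r₂ = ℕ-Ring.solve-∀
  pointwise : ∀ i → m ℕ.* (⟦ R i ⟧ ℕ.* deg G i) ≤ 2 ℕ.* N ℕ.* (⟦ R i ⟧ ℕ.* (deg G i ℕ.* deg G i))
  pointwise i with R i | R-heavy i
  ... | true  | d≥ = subst₂ _≤_ (cong (m ℕ.*_) (≡-sym (ℕ.*-identityˡ (deg G i)))) (ring N (deg G i)) (ℕ.*-monoˡ-≤ (deg G i) (d≥ tt))
    where
    ring : ∀ N d → 2 ℕ.* N ℕ.* d ℕ.* d ≡ 2 ℕ.* N ℕ.* (1 ℕ.* (d ℕ.* d))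
    ring = ℕ-Ring.solve-∀
  ... | false | _  = ℕ.≤-trans (ℕ.≤-reflexive (ℕ.*-zeroʳ m)) ℕ.z≤n
  average : m ℕ.* vol G R ≤ 2 ℕ.* N ℕ.* S
  average = subst₂ _≤_ (≡-sym (*-distribˡ-∑ℕ m (λ i → ⟦ R i ⟧ ℕ.* deg G i)))
    (trans (≡-sym (*-distribˡ-∑ℕ (2 ℕ.* N) (λ i → ⟦ R i ⟧ ℕ.* (deg G i ℕ.* deg G i)))) (cong (2 ℕ.* N ℕ.*_) (≡-sym (∑-vol-neighbours G R))))
    (∑ℕ-mono pointwise)
  isolated : ∀ v → ¬ T (U v) → ∀ i → ⟦ adj G v i ∧ R i ⟧ ℕ.* deg G i ≡ 0
  isolated v v∉U i with adj G v i | supp v i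
  ... | true  | v∈U = ⊥-elim (v∉U (v∈U tt))
  ... | false | _   = refl
  off : ∀ v → ¬ T (U v) → 8 ℕ.* (N ℕ.* N) ℕ.* vol G (neighbours G v R) ≡ 0
  off v v∉U = trans (cong (8 ℕ.* (N ℕ.* N) ℕ.*_) (∑ℕ-zero _ (isolated v v∉U))) (ℕ.*-zeroʳ (8 ℕ.* (N ℕ.* N)))

-- Greedy combination of disjoint pieces.

vol-split : ∀ {n} (G : Graph n) v (R : Fin n → Bool) → vol G R ≡ vol G (neighbours G v R) ℕ.+ vol G (non-neighbours G v R)
vol-split G v R = trans (∑ℕ-cong (λ i → entry (adj G v i) (R i) (deg G i))) (∑ℕ-distrib-+ _ _)
  where
  entry : ∀ a r d → ⟦ r ⟧ ℕ.* d ≡ ⟦ a ∧ r ⟧ ℕ.* d ℕ.+ ⟦ not a ∧ r ⟧ ℕ.* d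
  entry true  r d = ≡-sym (ℕ.+-identityʳ _)
  entry false r d = refl

∣i∣+c≤ : ∀ {a b c d} i → ∣ i ∣ ≤ a ℕ.+ b → b ℕ.+ c ≡ d → a ℕ.+ d ≤ 1 → ∣ i ∣ ℕ.+ c ≤ 1
∣i∣+c≤ {a} {b} {c} i i≤ b+c≡d a+d≤1 = ℕ.≤-trans (ℕ.+-monoˡ-≤ c i≤)
  (subst (_≤ 1) (trans (cong (a ℕ.+_) (≡-sym b+c≡d)) (≡-sym (ℕ.+-assoc a b c))) a+d≤1)

-- `M / L` is a guaranteed gain per unit of volume, so gains of successive pieces add up whatever
-- their sizes. Positive volume makes the remaining volume a termination measure.
Piece : ∀ {n} → Graph n → ℕ → ℕ → (Fin n → Bool) → Set
Piece {n} G M L R = ∃[ v ] 0 ℕ.< vol G (neighbours G v R) ×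
  Σ (Fin n → ℤ) λ x → (∀ i → ∣ x i ∣ ≤ ⟦ neighbours G v R i ⟧) × ∃[ g ]
    (vol G (neighbours G v R) ℕ.* M ≤ L ℕ.* g × + g ℤ.≤ ℤ.- centred G x)

Greedy : ∀ {n} → Graph n → ℕ → ℕ → Set
Greedy {n} G M L = Σ (Fin n → ℤ) λ y → (∀ i → ∣ y i ∣ ≤ 1) × ∃[ h ] (total G ℕ.* M ≤ 4 ℕ.* (L ℕ.* h) × + h ℤ.≤ ℤ.- centred G y)

module _ {n} (G : Graph n) (H : Fin n → Bool) (M L : ℕ) (0<m : 0 ℕ.< total G) (H-large : total G ≤ 2 ℕ.* vol G H)
  (extract : ∀ R → (∀ i → T (R i) → T (H i)) → total G ≤ 4 ℕ.* vol G R → Piece G M L R)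
  where

  -- h records the gain of the pieces extracted so far, which cover H ∖ R and support y.
  greedy : ∀ fuel R → vol G R ≤ fuel → (∀ i → T (R i) → T (H i)) →
    ∀ y → (∀ i → ∣ y i ∣ ℕ.+ ⟦ R i ⟧ ≤ 1) →
    ∀ h → vol G H ℕ.* M ≤ vol G R ℕ.* M ℕ.+ L ℕ.* h → + h ℤ.≤ ℤ.- centred G y → Greedy G M L
  greedy fuel R r≤ R⊆H y y≤ h progress h≤ with total G ℕ.≤? 4 ℕ.* vol G R
  ... | no  m≰4r = y , (λ i → ℕ.≤-trans (ℕ.m≤m+n ∣ y i ∣ ⟦ R i ⟧) (y≤ i)) , h , finished , h≤
    where
    open ℕ.≤-Reasoning
    m = total G
    ring₁ : ∀ m M → m ℕ.* M ℕ.+ m ℕ.* M ≡ 2 ℕ.* m ℕ.* M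
    ring₁ = ℕ-Ring.solve-∀
    ring₂ : ∀ v M → 2 ℕ.* (2 ℕ.* v) ℕ.* M ≡ 4 ℕ.* (v ℕ.* M)
    ring₂ = ℕ-Ring.solve-∀
    ring₃ : ∀ v M l → 4 ℕ.* (v ℕ.* M ℕ.+ l) ≡ 4 ℕ.* v ℕ.* M ℕ.+ 4 ℕ.* l
    ring₃ = ℕ-Ring.solve-∀
    -- `H` has volume at least m/2 and less than m/4 of it is left, so the pieces cover at least
    -- m/4.
    finished : m ℕ.* M ≤ 4 ℕ.* (L ℕ.* h)
    finished = ℕ.+-cancelˡ-≤ (m ℕ.* M) _ _ (begin
      m ℕ.* M ℕ.+ m ℕ.* M                              ≡⟨ ring₁ m M ⟩
      2 ℕ.* m ℕ.* M                                    ≤⟨ ℕ.*-monoˡ-≤ M (ℕ.*-monoʳ-≤ 2 H-large) ⟩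
      2 ℕ.* (2 ℕ.* vol G H) ℕ.* M                      ≡⟨ ring₂ (vol G H) M ⟩
      4 ℕ.* (vol G H ℕ.* M)                            ≤⟨ ℕ.*-monoʳ-≤ 4 progress ⟩
      4 ℕ.* (vol G R ℕ.* M ℕ.+ L ℕ.* h)                ≡⟨ ring₃ (vol G R) M (L ℕ.* h) ⟩
      4 ℕ.* vol G R ℕ.* M ℕ.+ 4 ℕ.* (L ℕ.* h)          ≤⟨ ℕ.+-monoˡ-≤ _ (ℕ.*-monoˡ-≤ M (ℕ.<⇒≤ (ℕ.≰⇒> m≰4r))) ⟩
      m ℕ.* M ℕ.+ 4 ℕ.* (L ℕ.* h)                      ∎)
  greedy zero R r≤ R⊆H y y≤ h progress h≤ | yes m≤4r = ⊥-elim (ℕ.<⇒≱ 0<m (ℕ.≤-trans m≤4r (ℕ.*-monoʳ-≤ 4 r≤)))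
  greedy (suc fuel) R r≤ R⊆H y y≤ h progress h≤ | yes m≤4r with extract R R⊆H m≤4r
  ... | v , 0<z , x , x≤ , g , zM≤Lg , g≤ = continue (either≤ (centred-parallelogram G y x))
    where
    W = neighbours G v R
    R′ = non-neighbours G v R
    r≡ : vol G R ≡ vol G W ℕ.+ vol G R′
    r≡ = vol-split G v R
    r′≤ : vol G R′ ≤ fuel
    r′≤ = ℕ.s≤s⁻¹ (ℕ.≤-trans (ℕ.≤-trans (ℕ.+-monoˡ-≤ (vol G R′) 0<z) (ℕ.≤-reflexive (≡-sym r≡))) r≤)
    R′⊆H : ∀ i → T (R′ i) → T (H i)
    R′⊆H i i∈R′ = R⊆H i (proj₂ (Equivalence.to (T-∧ {not (adj G v i)}) i∈R′))
    entry : ∀ a r → ⟦ a ∧ r ⟧ ℕ.+ ⟦ not a ∧ r ⟧ ≡ ⟦ r ⟧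
    entry true  r = ℕ.+-identityʳ ⟦ r ⟧
    entry false r = refl
    ring : ∀ z r M k → (z ℕ.+ r) ℕ.* M ℕ.+ k ≡ r ℕ.* M ℕ.+ (z ℕ.* M ℕ.+ k)
    ring = ℕ-Ring.solve-∀
    progress′ : vol G H ℕ.* M ≤ vol G R′ ℕ.* M ℕ.+ L ℕ.* (g ℕ.+ h)
    progress′ = begin
      vol G H ℕ.* M                                          ≤⟨ progress ⟩
      vol G R ℕ.* M ℕ.+ L ℕ.* h                              ≡⟨ cong (λ t → t ℕ.* M ℕ.+ L ℕ.* h) r≡ ⟩
      (vol G W ℕ.+ vol G R′) ℕ.* M ℕ.+ L ℕ.* h               ≡⟨ ring (vol G W) (vol G R′) M (L ℕ.* h) ⟩
      vol G R′ ℕ.* M ℕ.+ (vol G W ℕ.* M ℕ.+ L ℕ.* h)         ≤⟨ ℕ.+-monoʳ-≤ (vol G R′ ℕ.* M) (ℕ.+-monoˡ-≤ (L ℕ.* h) zM≤Lg) ⟩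
      vol G R′ ℕ.* M ℕ.+ (L ℕ.* g ℕ.+ L ℕ.* h)               ≡⟨ cong (vol G R′ ℕ.* M ℕ.+_) (≡-sym (ℕ.*-distribˡ-+ L g h)) ⟩
      vol G R′ ℕ.* M ℕ.+ L ℕ.* (g ℕ.+ h)                     ∎
      where open ℕ.≤-Reasoning
    value : ∀ {c} → c ℤ.≤ centred G y ℤ.+ centred G x → + (g ℕ.+ h) ℤ.≤ ℤ.- c
    value {c} c≤ = begin
      + g ℤ.+ + h                               ≤⟨ ℤ.+-mono-≤ g≤ h≤ ⟩
      ℤ.- centred G x ℤ.+ (ℤ.- centred G y)     ≡⟨ neg-swap (centred G x) (centred G y) ⟩
      ℤ.- (centred G y ℤ.+ centred G x)         ≤⟨ ℤ.neg-mono-≤ c≤ ⟩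
      ℤ.- c                                     ∎
      where
      open ℤ.≤-Reasoning
      neg-swap : ∀ a b → (ℤ.- a) ℤ.+ (ℤ.- b) ≡ ℤ.- (b ℤ.+ a)
      neg-swap = ℤ-Ring.solve-∀
    -- The supports are disjoint, so both signs give the same bounds on the entries and the same
    -- recorded gain.
    continue : centred G (λ i → y i ℤ.+ x i) ℤ.≤ centred G y ℤ.+ centred G x ⊎
               centred G (λ i → y i ℤ.- x i) ℤ.≤ centred G y ℤ.+ centred G x → Greedy G M L
    continue (inj₁ c≤) = greedy fuel R′ r′≤ R′⊆H (λ i → y i ℤ.+ x i)
      (λ i → ∣i∣+c≤ (y i ℤ.+ x i) (ℕ.≤-trans (ℤ.∣i+j∣≤∣i∣+∣j∣ (y i) (x i)) (ℕ.+-monoʳ-≤ ∣ y i ∣ (x≤ i))) (entry (adj G v i) (R i)) (y≤ i))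
      (g ℕ.+ h) progress′ (value c≤)
    continue (inj₂ c≤) = greedy fuel R′ r′≤ R′⊆H (λ i → y i ℤ.- x i)
      (λ i → ∣i∣+c≤ (y i ℤ.- x i) (ℕ.≤-trans (ℤ.∣i-j∣≤∣i∣+∣j∣ (y i) (x i)) (ℕ.+-monoʳ-≤ ∣ y i ∣ (x≤ i))) (entry (adj G v i) (R i)) (y≤ i))
      (g ℕ.+ h) progress′ (value c≤)

  extract-all : Greedy G M L
  extract-all = greedy (vol G H) H ℕ.≤-refl (λ _ i∈H → i∈H) (λ _ → 0ℤ) (λ i → ⟦⟧-mono {H i} {true} (λ _ → tt)) 0
    (ℕ.m≤m+n (vol G H ℕ.* M) (L ℕ.* 0)) (ℤ.neg-mono-≤ (centred-0≤0 G))

-- The induction step.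

-- One factor `z` of the quadratic gain is traded for its lower bound m²/bQ, which makes the gain
-- linear in the volume.
extract-arithmetic : ∀ e b Q C q {z m g} → m ℕ.* m ≤ b ℕ.* Q ℕ.* z → z ℕ.* z ℕ.* m ℕ.^ e ≤ C ℕ.* (q ℕ.* g) →
  z ℕ.* m ℕ.^ suc (suc e) ≤ b ℕ.* Q ℕ.* (C ℕ.* q) ℕ.* g
extract-arithmetic e b Q C q {z} {m} {g} m²≤ z²≤ = begin
  z ℕ.* m ℕ.^ suc (suc e)                 ≡⟨ ring₁ z m (m ℕ.^ e) ⟩
  z ℕ.* m ℕ.^ e ℕ.* (m ℕ.* m)             ≤⟨ ℕ.*-monoʳ-≤ (z ℕ.* m ℕ.^ e) m²≤ ⟩
  z ℕ.* m ℕ.^ e ℕ.* (b ℕ.* Q ℕ.* z)       ≡⟨ ring₂ z (m ℕ.^ e) (b ℕ.* Q) ⟩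
  b ℕ.* Q ℕ.* (z ℕ.* z ℕ.* m ℕ.^ e)       ≤⟨ ℕ.*-monoʳ-≤ (b ℕ.* Q) z²≤ ⟩
  b ℕ.* Q ℕ.* (C ℕ.* (q ℕ.* g))           ≡⟨ ring₃ (b ℕ.* Q) C q g ⟩
  b ℕ.* Q ℕ.* (C ℕ.* q) ℕ.* g             ∎
  where
  open ℕ.≤-Reasoning
  ring₁ : ∀ z m p → z ℕ.* (m ℕ.* (m ℕ.* p)) ≡ z ℕ.* p ℕ.* (m ℕ.* m)
  ring₁ = ℕ-Ring.solve-∀
  ring₂ : ∀ z p a → z ℕ.* p ℕ.* (a ℕ.* z) ≡ a ℕ.* (z ℕ.* z ℕ.* p)
  ring₂ = ℕ-Ring.solve-∀
  ring₃ : ∀ a C q g → a ℕ.* (C ℕ.* (q ℕ.* g)) ≡ a ℕ.* (C ℕ.* q) ℕ.* g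
  ring₃ = ℕ-Ring.solve-∀

-- The factor `m` that rounding the centred form costs is exactly the one won by summing over a
-- volume proportional to `m`.
conclude-arithmetic : ∀ a b Q C q {m M g h} → 0 ℕ.< m → m ℕ.* M ≤ a ℕ.* (b ℕ.* Q ℕ.* (C ℕ.* q) ℕ.* h) →
  h ≤ a ℕ.* m ℕ.* g → M ≤ a ℕ.* b ℕ.* a ℕ.* C ℕ.* (g ℕ.* (Q ℕ.* q))
conclude-arithmetic a b Q C q {m} {M} {g} {h} 0<m mM≤ h≤ = ℕ.*-cancelˡ-≤ m {{ℕ.>-nonZero 0<m}} (begin
  m ℕ.* M                                                  ≤⟨ mM≤ ⟩
  a ℕ.* (b ℕ.* Q ℕ.* (C ℕ.* q) ℕ.* h)                      ≤⟨ ℕ.*-monoʳ-≤ a (ℕ.*-monoʳ-≤ (b ℕ.* Q ℕ.* (C ℕ.* q)) h≤) ⟩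
  a ℕ.* (b ℕ.* Q ℕ.* (C ℕ.* q) ℕ.* (a ℕ.* m ℕ.* g))        ≡⟨ ring a b m Q C q g ⟩
  m ℕ.* (a ℕ.* b ℕ.* a ℕ.* C ℕ.* (g ℕ.* (Q ℕ.* q)))        ∎)
  where
  open ℕ.≤-Reasoning
  ring : ∀ a b m Q C q g → a ℕ.* (b ℕ.* Q ℕ.* (C ℕ.* q) ℕ.* (a ℕ.* m ℕ.* g)) ≡ m ℕ.* (a ℕ.* b ℕ.* a ℕ.* C ℕ.* (g ℕ.* (Q ℕ.* q)))
  ring = ℕ-Ring.solve-∀

-- In the constant, one 4 comes from covering a quarter of the volume and the other from rounding
-- after the shift; 8 comes from the volume of a neighbourhood, and the last factor is the constant
-- of a single piece.
surplus-step : ∀ e K → 0 ℕ.< K → SurplusBound e K → SurplusBound (suc e) (4 ℕ.* 8 ℕ.* 4 ℕ.* (2 ℕ.* 8 ℕ.^ e ℕ.* K))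
surplus-step e K 0<K IH {n} G U supp free = by-cases (total G ℕ.≟ 0)
  where
  m = total G
  N = size U
  C = 2 ℕ.* 8 ℕ.^ e ℕ.* K
  q = (N ℕ.* N) ℕ.^ e
  L = 8 ℕ.* (N ℕ.* N) ℕ.* (C ℕ.* q)
  m≤N² : m ≤ N ℕ.* N
  m≤N² = total≤size² G U supp
  positive-factor : ∀ {a b} → 0 ℕ.< a ℕ.* b → 0 ℕ.< b
  positive-factor {a} {zero}  0<ab = ⊥-elim (ℕ.<-irrefl (≡-sym (ℕ.*-zeroʳ a)) 0<ab)
  positive-factor {a} {suc b} _    = ℕ.z<s
  0<N : 0 ℕ.< m → 0 ℕ.< N
  0<N 0<m = positive-factor {N} (ℕ.<-≤-trans 0<m m≤N²)

  gain : 0 ℕ.< m → ∀ R v → (∀ i → T (R i) → T (heavy G N i)) → 0 ℕ.< vol G (neighbours G v R) → Gain G N e K (neighbours G v R)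
  gain 0<m R v R⊆H 0<z = cases (2 ℕ.* m ℕ.* w ℕ.≤? vol G W ℕ.* vol G W)
    where
    W = neighbours G v R
    w = total (restrict G W)
    support : ∀ i j → T (adj (restrict G W) i j) → T (W i)
    support i j edge = proj₁ (Equivalence.to (T-∧ {W i}) (proj₁ (Equivalence.to (T-∧ {W i ∧ W j}) edge)))
    W-heavy : ∀ i → T (W i) → m ≤ 2 ℕ.* N ℕ.* deg G i
    W-heavy i i∈W = ℕ.≤ᵇ⇒≤ m _ (R⊆H i (proj₂ (Equivalence.to (T-∧ {adj G v i}) i∈W)))
    cases : Dec (2 ℕ.* m ℕ.* w ≤ vol G W ℕ.* vol G W) → Gain G N e K W
    cases (yes sparse) = sparse-gain G W N e K 0<K m≤N² sparse
    cases (no  dense)  = dense-gain G W N e K 0<m 0<z (size-heavy G W (2 ℕ.* N) W-heavy) (ℕ.<⇒≤ (ℕ.≰⇒> dense))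
      (proj₁ hyp) (proj₁ (proj₂ hyp)) (proj₁ (proj₂ (proj₂ hyp))) (proj₂ (proj₂ (proj₂ hyp)))
      where
      -- `W` becomes the new vertex set, so the bound involves `size W`, which its volume controls
      -- because its vertices are heavy.
      hyp = IH (restrict G W) W support (neighbours-free G v R e free)

  extract : 0 ℕ.< m → ∀ R → (∀ i → T (R i) → T (heavy G N i)) → m ≤ 4 ℕ.* vol G R → Piece G (m ℕ.^ suc (suc e)) L R
  extract 0<m R R⊆H m≤4r = v , 0<z , x , x≤ , g , extract-arithmetic e 8 (N ℕ.* N) C q m²≤ large , g≤
    where
    found = voluminous-neighbourhood G U supp (0<N 0<m) R (λ i i∈R → ℕ.≤ᵇ⇒≤ m _ (R⊆H i i∈R)) m≤4r
    v = proj₁ found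
    m²≤ = proj₂ found
    0<z : 0 ℕ.< vol G (neighbours G v R)
    0<z = positive-factor {8 ℕ.* (N ℕ.* N)} (ℕ.<-≤-trans (ℕ.*-mono-< 0<m 0<m) m²≤)
    piece = gain 0<m R v R⊆H 0<z
    x     = proj₁ piece
    x≤    = proj₁ (proj₂ piece)
    g     = proj₁ (proj₂ (proj₂ piece))
    large = proj₁ (proj₂ (proj₂ (proj₂ piece)))
    g≤    = proj₂ (proj₂ (proj₂ (proj₂ piece)))

  Conclusion : Set
  Conclusion = Σ (Fin n → Bool) λ s → ∃[ g ]
    (m ℕ.^ suc (suc e) ≤ 4 ℕ.* 8 ℕ.* 4 ℕ.* C ℕ.* (g ℕ.* (N ℕ.* N) ℕ.^ suc e) × + g ℤ.≤ ℤ.- energy G (σ ∘ s))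

  conclude : 0 ℕ.< m → Greedy G (m ℕ.^ suc (suc e)) L → Conclusion
  conclude 0<m (y , y≤1 , h , mM≤4Lh , h≤) = s , g , conclude-arithmetic 4 8 (N ℕ.* N) C q 0<m mM≤4Lh h≤4mg , g≤
    where
    rounded = signs-below-centred G y 0<m y≤1
    s     = proj₁ rounded
    bound = neg-energy (4 ℕ.* m) h (energy G (σ ∘ s)) (ℕ.*-monoʳ-< 4 0<m)
      (ℤ.≤-trans (proj₂ rounded) (subst (ℤ._≤ ℤ.- + h) (ℤ.neg-involutive (centred G y)) (ℤ.neg-mono-≤ h≤)))
    g     = proj₁ bound
    g≤    = proj₁ (proj₂ bound)
    h≤4mg = proj₂ (proj₂ bound)

  by-cases : Dec (m ≡ 0) → Conclusion
  by-cases (yes m≡0) = (λ _ → true) , 0 , ℕ.≤-trans (ℕ.≤-reflexive (cong (ℕ._^ suc (suc e)) m≡0)) ℕ.z≤n , edgeless⇒0≤-energy G m≡0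
  by-cases (no  m≢0) = conclude 0<m (extract-all G (heavy G N) (m ℕ.^ suc (suc e)) L 0<m (total≤2vol-heavy G U supp (0<N 0<m)) (extract 0<m))
    where
    0<m : 0 ℕ.< m
    0<m = ℕ.n≢0⇒n>0 m≢0

surplus-bound : ∀ e → ∃[ K ] 0 ℕ.< K × SurplusBound e K
-- Any positive constant suits edgeless graphs. Positivity is carried along for the sparse case and
-- for the final division by `K`.
surplus-bound zero = 1 , ℕ.z<s , base
  where
  base : SurplusBound 0 1
  base G U supp free = (λ _ → true) , 0 , ℕ.≤-reflexive (trans (ℕ.*-identityʳ (total G)) m≡0) ,
    edgeless⇒0≤-energy G m≡0
    where
    m≡0 = K₂-free⇒edgeless G free
surplus-bound (suc e) with surplus-bound e
... | K , 0<K , IH = _ , ℕ.*-monoʳ-< (4 ℕ.* 8 ℕ.* 4) (ℕ.*-mono-< (ℕ.*-monoʳ-< 2 (ℕ.m^n>0 8 e)) 0<K) , surplus-step e K 0<K IH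

-- From sign vectors to cuts.

∑ℕ-1 : ∀ n → ∑ℕ {n} (λ _ → 1) ≡ n
∑ℕ-1 zero    = ∑ℕ-zero {zero} (λ _ → 1) (λ ())
∑ℕ-1 (suc n) = trans (∑ℕ-suc (λ _ → 1)) (cong suc (∑ℕ-1 n))

sum-tabulate : ∀ {n} (f : Fin n → ℕ) → ListAction.sum (tabulate f) ≡ ∑ℕ f
sum-tabulate {zero}  f = ≡-sym (∑ℕ-zero f (λ ()))
sum-tabulate {suc n} f = trans (cong (f zero ℕ.+_) (sum-tabulate (f ∘ suc))) (≡-sym (∑ℕ-suc f))

sum-allFin : ∀ {n} (f : Fin n → ℕ) → ListAction.sum (map f (allFin n)) ≡ ∑ℕ f
sum-allFin f = trans (cong ListAction.sum (List.map-tabulate (λ i → i) f)) (sum-tabulate f)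

countPairs-∑ : ∀ {n} (p : Fin n → Fin n → Bool) →
  countPairs p ≡ ∑ℕ (λ i → ∑ℕ (λ j → ⟦ (toℕ i ℕ.<ᵇ toℕ j) ∧ p i j ⟧))
countPairs-∑ p = trans (sum-allFin _) (∑ℕ-cong (λ i → trans (sum-allFin _) (∑ℕ-cong (λ j → if-⟦⟧ ((toℕ i ℕ.<ᵇ toℕ j) ∧ p i j)))))
  where
  if-⟦⟧ : ∀ b → (if b then 1 else 0) ≡ ⟦ b ⟧
  if-⟦⟧ true  = refl
  if-⟦⟧ false = refl

∑∑-countPairs : ∀ {n} (p : Fin n → Fin n → Bool) → (∀ i j → p i j ≡ p j i) → (∀ i → p i i ≡ false) →
  ∑ℕ (λ i → ∑ℕ (λ j → ⟦ p i j ⟧)) ≡ countPairs p ℕ.+ countPairs p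
∑∑-countPairs p p-sym p-irrefl = begin
  ∑ℕ (λ i → ∑ℕ (λ j → ⟦ p i j ⟧))
    ≡⟨ ∑ℕ-cong (λ i → trans (∑ℕ-cong (trichotomy i)) (∑ℕ-distrib-+ _ _)) ⟩
  ∑ℕ (λ i → ∑ℕ (λ j → ⟦ (toℕ i ℕ.<ᵇ toℕ j) ∧ p i j ⟧) ℕ.+ ∑ℕ (λ j → ⟦ (toℕ j ℕ.<ᵇ toℕ i) ∧ p j i ⟧))
    ≡⟨ ∑ℕ-distrib-+ _ _ ⟩
  ∑ℕ (λ i → ∑ℕ (λ j → ⟦ (toℕ i ℕ.<ᵇ toℕ j) ∧ p i j ⟧)) ℕ.+ ∑ℕ (λ i → ∑ℕ (λ j → ⟦ (toℕ j ℕ.<ᵇ toℕ i) ∧ p j i ⟧))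
    ≡⟨ cong₂ ℕ._+_ (≡-sym (countPairs-∑ p)) (trans (∑ℕ-comm _) (≡-sym (countPairs-∑ p))) ⟩
  countPairs p ℕ.+ countPairs p ∎
  where
  open ≡-Reasoning
  below : ∀ {a b} → a ℕ.< b → (a ℕ.<ᵇ b) ≡ true
  below {a} {b} a<b with a ℕ.<ᵇ b | ℕ.<⇒<ᵇ a<b
  ... | true | _ = refl
  above : ∀ {a b} → ¬ a ℕ.< b → (a ℕ.<ᵇ b) ≡ false
  above {a} {b} a≮b with a ℕ.<ᵇ b in eq
  ... | false = refl
  ... | true  = ⊥-elim (a≮b (ℕ.<ᵇ⇒< a b (subst T (≡-sym eq) tt)))
  trichotomy : ∀ i j → ⟦ p i j ⟧ ≡ ⟦ (toℕ i ℕ.<ᵇ toℕ j) ∧ p i j ⟧ ℕ.+ ⟦ (toℕ j ℕ.<ᵇ toℕ i) ∧ p j i ⟧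
  trichotomy i j with ℕ.<-cmp (toℕ i) (toℕ j)
  ... | tri< i<j _ j≮i rewrite below i<j | above j≮i = ≡-sym (ℕ.+-identityʳ _)
  ... | tri> i≮j _ j<i rewrite above i≮j | below j<i = cong ⟦_⟧ (p-sym i j)
  ... | tri≈ i≮j i≡j j≮i rewrite above i≮j | above j≮i | Fin.toℕ-injective i≡j = cong ⟦_⟧ (p-irrefl j)

total≡2e : ∀ {n} (G : Graph n) → total G ≡ e G ℕ.+ e G
total≡2e G = ∑∑-countPairs (adj G) (sym G) (irrefl G)

-- On an edge the product of the two signs is 1 minus twice the indicator of crossing; the energy
-- runs over ordered pairs, which doubles both counts.
energy-cut : ∀ {n} (G : Graph n) (S : Fin n → Bool) → energy G (σ ∘ S) ≡
  + (e G ℕ.+ e G) ℤ.- (+ (cut G S ℕ.+ cut G S) ℤ.+ + (cut G S ℕ.+ cut G S))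
energy-cut G S = begin
  energy G (σ ∘ S)
    ≡⟨ ∑ℤ-cong (λ i → trans (∑ℤ-cong (λ j → entry (adj G i j) (S i) (S j)))
         (trans (∑ℤ-lin 1ℤ (-1ℤ ℤ.+ -1ℤ) _ _) (cong₂ (λ a b → 1ℤ ℤ.* a ℤ.+ (-1ℤ ℤ.+ -1ℤ) ℤ.* b) (≡-sym (+-∑ _)) (≡-sym (+-∑ _))))) ⟩
  ∑ℤ (λ i → 1ℤ ℤ.* + deg G i ℤ.+ (-1ℤ ℤ.+ -1ℤ) ℤ.* + ∑ℕ (λ j → ⟦ crossing i j ⟧))
    ≡⟨ trans (∑ℤ-lin 1ℤ (-1ℤ ℤ.+ -1ℤ) _ _) (cong₂ (λ a b → 1ℤ ℤ.* a ℤ.+ (-1ℤ ℤ.+ -1ℤ) ℤ.* b) (≡-sym (+-∑ _)) (≡-sym (+-∑ _))) ⟩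
  1ℤ ℤ.* + total G ℤ.+ (-1ℤ ℤ.+ -1ℤ) ℤ.* + ∑ℕ (λ i → ∑ℕ (λ j → ⟦ crossing i j ⟧))
    ≡⟨ cong₂ (λ a b → 1ℤ ℤ.* + a ℤ.+ (-1ℤ ℤ.+ -1ℤ) ℤ.* + b) (total≡2e G) (∑∑-countPairs crossing crossing-sym crossing-irrefl) ⟩
  1ℤ ℤ.* + (e G ℕ.+ e G) ℤ.+ (-1ℤ ℤ.+ -1ℤ) ℤ.* + (cut G S ℕ.+ cut G S)
    ≡⟨ ring (+ (e G ℕ.+ e G)) (+ (cut G S ℕ.+ cut G S)) ⟩
  + (e G ℕ.+ e G) ℤ.- (+ (cut G S ℕ.+ cut G S) ℤ.+ + (cut G S ℕ.+ cut G S)) ∎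
  where
  open ≡-Reasoning
  crossing : Fin _ → Fin _ → Bool
  crossing i j = adj G i j ∧ (S i xor S j)
  crossing-sym : ∀ i j → crossing i j ≡ crossing j i
  crossing-sym i j = cong₂ _∧_ (sym G i j) (xor-comm (S i) (S j))
  crossing-irrefl : ∀ i → crossing i i ≡ false
  crossing-irrefl i = cong (_∧ (S i xor S i)) (irrefl G i)
  entry : ∀ c a b → σ a ℤ.* (+ ⟦ c ⟧ ℤ.* σ b) ≡ 1ℤ ℤ.* + ⟦ c ⟧ ℤ.+ (-1ℤ ℤ.+ -1ℤ) ℤ.* + ⟦ c ∧ (a xor b) ⟧
  entry true  true  true  = refl
  entry true  true  false = refl
  entry true  false true  = refl
  entry true  false false = refl
  entry false true  true  = refl
  entry false true  false = refl
  entry false false true  = refl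
  entry false false false = refl
  ring : ∀ a b → 1ℤ ℤ.* a ℤ.+ (-1ℤ ℤ.+ -1ℤ) ℤ.* b ≡ a ℤ.- (b ℤ.+ b)
  ring = ℤ-Ring.solve-∀

-- Membership is up to pointwise equality, as functions are not extensional; `cut` respects it.
∈-subsets : ∀ n (S : Fin n → Bool) → Any (λ S′ → ∀ i → S i ≡ S′ i) (subsets n)
∈-subsets zero    S = here (λ ())
∈-subsets (suc n) S = concatMap⁺ _ (Any.map (extend (S zero) refl) (∈-subsets n (S ∘ suc)))
  where
  extend : ∀ b → S zero ≡ b → ∀ {S′ : Fin n → Bool} → (∀ i → S (suc i) ≡ S′ i) →
    Any (λ S″ → ∀ i → S i ≡ S″ i) ((true ∷ᵥ S′) ∷ (false ∷ᵥ S′) ∷ [])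
  extend true  S₀ eq = here λ { zero → S₀ ; (suc i) → eq i }
  extend false S₀ eq = there (here λ { zero → S₀ ; (suc i) → eq i })

cut≤mc : ∀ {n} (G : Graph n) (S : Fin n → Bool) → cut G S ≤ mc G
cut≤mc {n} G S = bounded (∈-subsets n S)
  where
  cut-cong : ∀ {S′} → (∀ i → S i ≡ S′ i) → cut G S ≡ cut G S′
  cut-cong S≗S′ = trans (countPairs-∑ _) (trans (∑ℕ-cong (λ i → ∑ℕ-cong (λ j →
    cong₂ (λ a b → ⟦ (toℕ i ℕ.<ᵇ toℕ j) ∧ (adj G i j ∧ (a xor b)) ⟧) (S≗S′ i) (S≗S′ j)))) (≡-sym (countPairs-∑ _)))
  bounded : ∀ {Ss} → Any (λ S′ → ∀ i → S i ≡ S′ i) Ss → cut G S ≤ foldr ℕ._⊔_ 0 (map (cut G) Ss)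
  bounded (here S≗S′)  = ℕ.≤-trans (ℕ.≤-reflexive (cut-cong S≗S′)) (ℕ.m≤m⊔n _ _)
  bounded (there S∈Ss) = ℕ.≤-trans (bounded S∈Ss) (ℕ.m≤n⊔m _ _)

-- The right-hand side is four times `sp G`, written with the numerator of `sp G` over 2.
neg-energy≤mc : ∀ {n} (G : Graph n) (S : Fin n → Bool) → ℤ.- energy G (σ ∘ S) ℤ.≤ + 2 ℤ.* (+ 2 ℤ.* + mc G ℤ.- + e G)
neg-energy≤mc G S = begin
  ℤ.- energy G (σ ∘ S)                             ≡⟨ cong ℤ.-_ (energy-cut G S) ⟩
  ℤ.- (+ e₂ ℤ.- (+ c₂ ℤ.+ + c₂))                   ≡⟨ ring₁ (+ e G) (+ cut G S) ⟩
  + 2 ℤ.* (+ 2 ℤ.* + cut G S ℤ.- + e G)            ≤⟨ ℤ.*-monoˡ-≤-nonNeg (+ 2) (ℤ.+-monoˡ-≤ (ℤ.- + e G) (ℤ.*-monoˡ-≤-nonNeg (+ 2) (ℤ.+≤+ (cut≤mc G S)))) ⟩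
  + 2 ℤ.* (+ 2 ℤ.* + mc G ℤ.- + e G)               ∎
  where
  open ℤ.≤-Reasoning
  e₂ = e G ℕ.+ e G
  c₂ = cut G S ℕ.+ cut G S
  ring₁ : ∀ e c → ℤ.- ((e ℤ.+ e) ℤ.- ((c ℤ.+ c) ℤ.+ (c ℤ.+ c))) ≡ (1ℤ ℤ.+ 1ℤ) ℤ.* ((1ℤ ℤ.+ 1ℤ) ℤ.* c ℤ.- e)
  ring₁ = ℤ-Ring.solve-∀

-- Translation to rationals and the theorem.

toℚᵘ-/ : ∀ i d .{{_ : NonZero d}} → toℚᵘ (i / d) ≃ (i ℚᵘ./ d)
toℚᵘ-/ i (suc d) = ℚ.toℚᵘ-fromℚᵘ (mkℚᵘ i d)

/ᵘ-* : ∀ i j c d .{{_ : NonZero c}} .{{_ : NonZero d}} →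
  ((i ℚᵘ./ c) ℚᵘ.* (j ℚᵘ./ d)) ≃ ((i ℤ.* j) ℚᵘ./ (c ℕ.* d)) {{ℕ.m*n≢0 c d}}
/ᵘ-* i j (suc c) (suc d) = ℚᵘ.≃-refl

toℚᵘ-* : ∀ {p q i j} c d .{{_ : NonZero c}} .{{_ : NonZero d}} → toℚᵘ p ≃ (i ℚᵘ./ c) → toℚᵘ q ≃ (j ℚᵘ./ d) →
  toℚᵘ (p * q) ≃ ((i ℤ.* j) ℚᵘ./ (c ℕ.* d)) {{ℕ.m*n≢0 c d}}
toℚᵘ-* {p} {q} {i} {j} c d p≃ q≃ = ℚᵘ.≃-trans (ℚ.toℚᵘ-homo-* p q) (ℚᵘ.≃-trans (ℚᵘ.*-cong p≃ q≃) (/ᵘ-* i j c d))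

toℚᵘ-^ : ∀ a d .{{_ : NonZero d}} k → toℚᵘ (((+ a) / d) ^ℚ k) ≃ ((+ (a ℕ.^ k)) ℚᵘ./ (d ℕ.^ k)) {{ℕ.m^n≢0 d k}}
toℚᵘ-^ a d zero    = ℚᵘ.≃-refl
toℚᵘ-^ a d (suc k) = subst (λ i → toℚᵘ (((+ a) / d) ^ℚ suc k) ≃ (i ℚᵘ./ (d ℕ.^ suc k)) {{ℕ.m^n≢0 d (suc k)}})
  (≡-sym (ℤ.pos-* a (a ℕ.^ k)))
  (toℚᵘ-* d (d ℕ.^ k) {{_}} {{ℕ.m^n≢0 d k}} (toℚᵘ-/ (+ a) d) (toℚᵘ-^ a d k))

-- `mkℚᵘ` stores the denominator less one, so the final 1 stands for the denominator 2.
toℚᵘ-sp : ∀ {n} (G : Graph n) → toℚᵘ (sp G) ≃ mkℚᵘ (+ 2 ℤ.* + mc G ℤ.- + e G) 1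
toℚᵘ-sp G = ℚᵘ.≃-trans (ℚ.toℚᵘ-homo-+ ((+ mc G) / 1) _)
  (ℚᵘ.≃-trans (ℚᵘ.+-cong (toℚᵘ-/ (+ mc G) 1) (ℚᵘ.≃-trans (ℚ.toℚᵘ-homo‿- ((+ e G) / 2)) (ℚᵘ.-‿cong (toℚᵘ-/ (+ e G) 2))))
    (ℚᵘ.≃-reflexive (cong (λ i → mkℚᵘ i 1) (ring (+ mc G) (+ e G)))))
  where
  ring : ∀ c e → c ℤ.* (1ℤ ℤ.+ 1ℤ) ℤ.+ (ℤ.- e) ℤ.* 1ℤ ≡ (1ℤ ℤ.+ 1ℤ) ℤ.* c ℤ.- e
  ring = ℤ-Ring.solve-∀

/ᵘ≤mkℚᵘ : ∀ i d j c .{{_ : NonZero d}} → i ℤ.* + suc c ℤ.≤ j ℤ.* + d → (i ℚᵘ./ d) ℚᵘ.≤ mkℚᵘ j c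
/ᵘ≤mkℚᵘ i (suc d) j c le = *≤* le

-- With `d = 2e(G)/n` the quotient d^(k+2)/n^k has denominator n^(k+2) n^k = (n²)^(k+1), the power
-- in the inductive bound when `U` is everything. The 4 in the constant is the ratio of minus the
-- energy to the surplus.
sp-bound : ∀ k K n .{{_ : NonZero n}} .{{_ : NonZero (4 ℕ.* K)}} (G : Graph n) s g →
  total G ℕ.^ (2 ℕ.+ k) ≤ K ℕ.* (g ℕ.* (size {n} (λ _ → true) ℕ.* size {n} (λ _ → true)) ℕ.^ suc k) →
  + g ℤ.≤ ℤ.- energy G (σ ∘ s) →
  ((+ 1) / (4 ℕ.* K)) * ((avgDeg G ^ℚ (2 ℕ.+ k)) * (((+ 1) / n) ^ℚ k)) ≤ℚ sp G
sp-bound k K n G s g large g≤ = ℚ.toℚᵘ-cancel-≤ (ℚᵘ.≤-respˡ-≃ (ℚᵘ.≃-sym lhs) (ℚᵘ.≤-respʳ-≃ (ℚᵘ.≃-sym (toℚᵘ-sp G))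
    (/ᵘ≤mkℚᵘ (+ 1 ℤ.* (+ A ℤ.* + (1 ℕ.^ k))) (4 ℕ.* K ℕ.* D) X 1 {{4KD≢0}} final)))
  where
  a = 2 ℕ.* e G
  A = a ℕ.^ (2 ℕ.+ k)
  D = n ℕ.^ (2 ℕ.+ k) ℕ.* n ℕ.^ k
  X = + 2 ℤ.* + mc G ℤ.- + e G
  instance
    n^k≢0 = ℕ.m^n≢0 n k
    n^k+2≢0 = ℕ.m^n≢0 n (2 ℕ.+ k)
    D≢0 = ℕ.m*n≢0 (n ℕ.^ (2 ℕ.+ k)) (n ℕ.^ k)
  4KD≢0 : NonZero (4 ℕ.* K ℕ.* D)
  4KD≢0 = ℕ.m*n≢0 (4 ℕ.* K) D
  lhs : toℚᵘ (((+ 1) / (4 ℕ.* K)) * ((avgDeg G ^ℚ (2 ℕ.+ k)) * (((+ 1) / n) ^ℚ k)))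
      ≃ ((+ 1 ℤ.* (+ A ℤ.* + (1 ℕ.^ k))) ℚᵘ./ (4 ℕ.* K ℕ.* D)) {{4KD≢0}}
  lhs = toℚᵘ-* (4 ℕ.* K) D (toℚᵘ-/ (+ 1) (4 ℕ.* K))
    (toℚᵘ-* (n ℕ.^ (2 ℕ.+ k)) (n ℕ.^ k) (toℚᵘ-^ a n (2 ℕ.+ k)) (toℚᵘ-^ 1 n k))
  A≤ : A ≤ K ℕ.* (g ℕ.* D)
  A≤ = subst₂ (λ p q → p ℕ.^ (2 ℕ.+ k) ≤ K ℕ.* (g ℕ.* q))
    (trans (total≡2e G) (cong (e G ℕ.+_) (≡-sym (ℕ.+-identityʳ (e G)))))
    (trans (cong (λ N → (N ℕ.* N) ℕ.^ suc k) (∑ℕ-1 n)) (trans (^-distribʳ-* (suc k) n n) (ring n (n ℕ.^ k)))) large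
    where
    ring : ∀ n q → n ℕ.* q ℕ.* (n ℕ.* q) ≡ n ℕ.* (n ℕ.* q) ℕ.* q
    ring = ℕ-Ring.solve-∀
  final : + 1 ℤ.* (+ A ℤ.* + (1 ℕ.^ k)) ℤ.* + 2 ℤ.≤ X ℤ.* + (4 ℕ.* K ℕ.* D)
  final = begin
    + 1 ℤ.* (+ A ℤ.* + (1 ℕ.^ k)) ℤ.* + 2    ≡⟨ cong (λ t → + 1 ℤ.* (+ A ℤ.* + t) ℤ.* + 2) (ℕ.^-zeroˡ k) ⟩
    + 1 ℤ.* (+ A ℤ.* + 1) ℤ.* + 2            ≡⟨ ring₁ (+ A) ⟩
    + A ℤ.* + 2                              ≤⟨ ℤ.*-monoʳ-≤-nonNeg (+ 2) (ℤ.+≤+ A≤) ⟩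
    + (K ℕ.* (g ℕ.* D)) ℤ.* + 2              ≡⟨ cong (ℤ._* + 2) (trans (ℤ.pos-* K (g ℕ.* D)) (cong (+ K ℤ.*_) (ℤ.pos-* g D))) ⟩
    + K ℤ.* (+ g ℤ.* + D) ℤ.* + 2            ≡⟨ ring₂ (+ K) (+ g) (+ D) ⟩
    + g ℤ.* (+ K ℤ.* + D ℤ.* + 2)            ≡⟨ cong (λ t → + g ℤ.* (t ℤ.* + 2)) (≡-sym (ℤ.pos-* K D)) ⟩
    + g ℤ.* (+ (K ℕ.* D) ℤ.* + 2)            ≡⟨ cong (+ g ℤ.*_) (≡-sym (ℤ.pos-* (K ℕ.* D) 2)) ⟩
    + g ℤ.* + (K ℕ.* D ℕ.* 2)                ≤⟨ ℤ.*-monoʳ-≤-nonNeg (+ (K ℕ.* D ℕ.* 2)) (ℤ.≤-trans g≤ (neg-energy≤mc G s)) ⟩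
    + 2 ℤ.* X ℤ.* + (K ℕ.* D ℕ.* 2)          ≡⟨ ring₃ (+ 2) X (+ (K ℕ.* D ℕ.* 2)) ⟩
    X ℤ.* (+ 2 ℤ.* + (K ℕ.* D ℕ.* 2))        ≡⟨ cong (X ℤ.*_) (trans (≡-sym (ℤ.pos-* 2 (K ℕ.* D ℕ.* 2))) (cong +_ (ring₄ K D))) ⟩
    X ℤ.* + (4 ℕ.* K ℕ.* D)                  ∎
    where
    open ℤ.≤-Reasoning
    ring₁ : ∀ a → 1ℤ ℤ.* (a ℤ.* 1ℤ) ℤ.* (1ℤ ℤ.+ 1ℤ) ≡ a ℤ.* (1ℤ ℤ.+ 1ℤ)
    ring₁ = ℤ-Ring.solve-∀
    ring₂ : ∀ K g D → K ℤ.* (g ℤ.* D) ℤ.* (1ℤ ℤ.+ 1ℤ) ≡ g ℤ.* (K ℤ.* D ℤ.* (1ℤ ℤ.+ 1ℤ))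
    ring₂ = ℤ-Ring.solve-∀
    ring₃ : ∀ t x y → t ℤ.* x ℤ.* y ≡ x ℤ.* (t ℤ.* y)
    ring₃ = ℤ-Ring.solve-∀
    ring₄ : ∀ K D → 2 ℕ.* (K ℕ.* D ℕ.* 2) ≡ 4 ℕ.* K ℕ.* D
    ring₄ = ℕ-Ring.solve-∀

theorem1p6 : (r : ℕ) → 3 ≤ r →
    Σ ℚ (λ c → Positive c ×
    ((n : ℕ) → .{{_ : NonZero n}} → (G : Graph n) → KrFree r G →
    c * ((avgDeg G ^ℚ (r ∸ 1)) * (((+ 1) / n) ^ℚ (r ∸ 3))) ≤ℚ sp G))
-- Here `r = 3 + k`, which is `2 + e` for `e = suc k`.
theorem1p6 (suc (suc (suc k))) (ℕ.s≤s (ℕ.s≤s (ℕ.s≤s _))) = from-bound (surplus-bound (suc k))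
  where
  from-bound : ∃[ K ] 0 ℕ.< K × SurplusBound (suc k) K → Σ ℚ (λ c → Positive c ×
    ((n : ℕ) → .{{_ : NonZero n}} → (G : Graph n) → KrFree (3 ℕ.+ k) G →
    c * ((avgDeg G ^ℚ (2 ℕ.+ k)) * (((+ 1) / n) ^ℚ k)) ≤ℚ sp G))
  from-bound (K , 0<K , bound) = (+ 1) / (4 ℕ.* K) , ℚ.normalize-pos 1 (4 ℕ.* K) ,
    λ n G free → let (s , g , large , g≤) = bound G (λ _ → true) (λ _ _ _ → tt) free in
      sp-bound k K n G s g large g≤
    where
    instance
      K≢0 = ℕ.>-nonZero 0<K
      4K≢0 = ℕ.m*n≢0 4 K
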